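{- Let $G$ be a connected ribbon graph and $A\subseteq E(G)$. Then $A$ defines a biseparation of $G$ if and only if \[ \gamma(G^A)=\gamma(G|_A)+\gamma(G-A). \] Furthermore, if $A$ defines a biseparation of $G$, then $G^A$ is orientable if and only if both $G|_A$ and $G-A$ are orientable.
   Context: A ribbon graph $G=(V(G),E(G))$ is a (possibly non-orientable) surface with boundary represented as the union of two sets of closed discs, a set $V(G)$ of vertices and a set $E(G)$ of edges, such that: vertices and edges intersect in disjoint line segments; each such segment lies on the boundary of precisely one vertex and precisely one edge; every edge contains exactly two such segments. Ribbon graphs are considered up to homeomorphism (equivalently, they are cellularly embedded graphs). For $A\subseteq E(G)$, write $A^c=E(G)\setminus A$; $G|_A$ is the ribbon subgraph consisting of the edges in $A$ and their incident vertices; $G-A$ is obtained from $G$ by deleting the edges in $A$ (keeping all vertices). The Euler genus $\gamma$ of a connected ribbon graph (viewed as a punctured surface) is twice its genus if it is orientable and its (non-orientable) genus otherwise; for a disconnected ribbon graph $\gamma$ is the sum over components. Partial dual: for $A\subseteq E(G)$, arbitrarily orient the boundary of each edge of $G$. The boundary components of the spanning ribbon subgraph $(V(G),A)$ (naturally embedded in $G$) meet the edges of $G$ in disjoint arcs; on each such arc place an arrow pointing in the direction of the orientation of that edge's boundary and labelled by that edge. Taking each marked boundary component as the boundary of a new vertex disc, and, for each edge label $e$, attaching an edge disc by gluing two disjoint arcs of its (oriented) boundary to the two $e$-labelled arrows consistently with their directions, gives the partial dual $G^A$. Edges of $G^A$ are identified with those of $G$. $n$-sums: for a connected ribbon graph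 $G$ and non-trivial (not an isolated vertex) connected ribbon subgraphs $P,Q$ with $G=P\cup Q$ and $P\cap Q=\{v_1,\dots,v_n\}$ (vertices), $G$ is the $n$-sum $P\oplus_n Q$; write $\oplus$ for $\oplus_1$. $G$ is written as a sequence of $1$-sums $G=H_1\oplus H_2\oplus\cdots\oplus H_l$ meaning $(\cdots((H_1\oplus H_2)\oplus H_3)\cdots)\oplus H_l$ with each $H_i$ a ribbon subgraph of $G$ and each step a $1$-sum. Biseparation: $A\subseteq E(G)$ defines a biseparation of connected $G$ if either $A=E(G)$ or $A=\emptyset$, or $G$ can be written as a sequence of $1$-sums whose summands are the components of $G|_A$ and of $G|_{A^c}$ and in which each $1$-sum involves a component of $G|_A$ and a component of $G|_{A^c}$. -}

module Defs where

-- Combinatorial model of ribbon graphs via graph-encoded maps (gems).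

open import Data.Nat using (ℕ; zero; suc; _+_; _*_; _<ᵇ_; _<_; _≤_)
open import Data.Bool using (Bool; true; false; not; _∧_; _∨_; if_then_else_; T)
open import Data.Bool.Properties using () renaming (_≟_ to _≟ᵇ_)
open import Data.Fin using (Fin; toℕ)
open import Data.Fin.Properties using () renaming (_≟_ to _≟ᶠ_)
open import Data.Product using (Σ; ∃; _×_; _,_; proj₁; proj₂)
open import Data.Sum using (_⊎_)
open import Data.List using (List; []; _∷_; _++_; map; length; concatMap; filterᵇ; allFin)
open import Data.Bool.ListAction using (any)
open import Data.Integer using (ℤ; +_; _-_) renaming (_+_ to _+ℤ_)
open import Function using (_∘_)
open import Function.Bundles using (_⇔_)
open import Relation.Binary.PropositionalEquality using (_≡_; _≢_)
open import Relation.Nullary using (¬_)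
open import Relation.Nullary.Decidable using (⌊_⌋)

-- Flags.  A flag of an edge e is (e , end , side): each edge carries four
-- flags.  θ₀ switches the end of the edge, θ₂ switches the side.

Flag : ℕ → Set
Flag m = Fin m × Bool × Bool

edgeOf : ∀ {m} → Flag m → Fin m
edgeOf (e , _ , _) = e

θ₀ : ∀ {m} → Flag m → Flag m
θ₀ (e , a , b) = e , not a , b

θ₂ : ∀ {m} → Flag m → Flag m
θ₂ (e , a , b) = e , a , not b

_==_ : ∀ {m} → Flag m → Flag m → Bool
(e , a , b) == (e' , a' , b') = ⌊ e ≟ᶠ e' ⌋ ∧ ⌊ a ≟ᵇ a' ⌋ ∧ ⌊ b ≟ᵇ b' ⌋

allFlags : (m : ℕ) → List (Flag m)
allFlags m = concatMap (λ e → (e , false , false) ∷ (e , false , true)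
                            ∷ (e , true , false) ∷ (e , true , true) ∷ []) (allFin m)

EdgeSet : ℕ → Set
EdgeSet m = Fin m → Bool

-- Ribbon graphs.  Edge labels are Fin m, the edges actually present are
-- those in the mask E (so subgraphs and partial duals keep the labels of
-- G).  θ₁ is the corner involution of the gem; nIso counts isolated
-- vertices (vertices with no incident edge; they carry no flags).

record RibbonGraph : Set where
  constructor ribbonGraph
  field
    m    : ℕ
    E    : EdgeSet m
    θ₁   : Flag m → Flag m
    nIso : ℕ

open RibbonGraph public

InE : (G : RibbonGraph) → Flag (m G) → Set
InE G x = T (E G (edgeOf x))

record WF (G : RibbonGraph) : Set where
  field
    θ₁-closed : ∀ x → InE G x → InE G (θ₁ G x)
    θ₁-invol  : ∀ x → InE G x → θ₁ G (θ₁ G x) ≡ x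
    θ₁-fpf    : ∀ x → InE G x → θ₁ G x ≢ x

flags : (G : RibbonGraph) → List (Flag (m G))
flags G = filterᵇ (E G ∘ edgeOf) (allFlags (m G))

closeIn : ∀ {X : Set} → ℕ → List (X → X) → (X → X → Bool) → List X → List X
closeIn zero    gs eq S = S
closeIn (suc k) gs eq S = closeIn k gs eq (addAll S (concatMap (λ x → map (λ g → g x) gs) S))
  where
  addAll : List _ → List _ → List _
  addAll acc []       = acc
  addAll acc (y ∷ ys) = if any (eq y) acc then addAll acc ys else addAll (acc ++ (y ∷ [])) ys

reachIn : ∀ {X : Set} → ℕ → List (X → X) → (X → X → Bool) → X → X → Bool
reachIn k gs eq x y = any (eq y) (closeIn k gs eq (x ∷ []))

Reach : (G : RibbonGraph) → List (Flag (m G) → Flag (m G)) → Flag (m G) → Flag (m G) → Bool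
Reach G gs = reachIn (length (flags G)) gs _==_

countClasses : ∀ {X : Set} → (X → X → Bool) → (X → Bool) → List X → ℕ
countClasses {X} R P = go []
  where
  go : List X → List X → ℕ
  go seen []       = 0
  go seen (x ∷ xs) = (if any (R x) seen then 0 else (if P x then 1 else 0)) + go (x ∷ seen) xs

countOrbits : (G : RibbonGraph) → List (Flag (m G) → Flag (m G)) → ℕ
countOrbits G gs = countClasses (Reach G gs) (λ _ → true) (flags G)

RV : (G : RibbonGraph) → Flag (m G) → Flag (m G) → Bool
RV G = Reach G (θ₁ G ∷ θ₂ ∷ [])

#V #E #F #K : RibbonGraph → ℕ
#V G = countOrbits G (θ₁ G ∷ θ₂ ∷ []) + nIso G
#E G = length (filterᵇ (E G) (allFin (m G)))
#F G = countOrbits G (θ₀ ∷ θ₁ G ∷ []) + nIso G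
#K G = countOrbits G (θ₀ ∷ θ₁ G ∷ θ₂ ∷ []) + nIso G

-- Euler genus (sum over components of the Euler genus of the surface):
-- γ = 2k − v + e − f
γ : RibbonGraph → ℤ
γ G = ((+ (2 * #K G) - + (#V G)) +ℤ + (#E G)) - + (#F G)

Connected : RibbonGraph → Set
Connected G = #K G ≡ 1

-- orientable: every component is orientable, i.e. the gem is bipartite
Orientable : RibbonGraph → Set
Orientable G = Σ (Flag (m G) → Bool) λ c → ∀ x → InE G x →
  (c (θ₀ x) ≢ c x) × (c (θ₁ G x) ≢ c x) × (c (θ₂ x) ≢ c x)

-- corner involution after deleting every edge outside the mask B:
-- go round the vertex, skipping the half-edges of deleted edges
skip : ∀ {m} → ℕ → EdgeSet m → (Flag m → Flag m) → Flag m → Flag m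
skip zero    B t x = t x
skip (suc k) B t x = if B (edgeOf (t x)) then t x else skip k B t (θ₂ (t x))

_∩ₑ_ : ∀ {m} → EdgeSet m → EdgeSet m → EdgeSet m
(S ∩ₑ T') e = S e ∧ T' e

isolatedBy : (G : RibbonGraph) → EdgeSet (m G) → ℕ
isolatedBy G B = countClasses (RV G)
  (λ x → not (any (λ y → RV G x y ∧ B (edgeOf y)) (flags G))) (flags G)

-- G|_A : edges of A and their incident vertices
_∣_ : (G : RibbonGraph) → EdgeSet (m G) → RibbonGraph
G ∣ A = ribbonGraph (m G) (E G ∩ₑ A) (skip (4 * m G) (E G ∩ₑ A) (θ₁ G)) 0

_ᶜ[_] : ∀ {m} → EdgeSet m → EdgeSet m → EdgeSet m
(A ᶜ[ Ed ]) e = Ed e ∧ not (A e)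

-- G − A : delete the edges of A, keep all vertices
_⊖_ : (G : RibbonGraph) → EdgeSet (m G) → RibbonGraph
G ⊖ A = ribbonGraph (m G) (A ᶜ[ E G ]) (skip (4 * m G) (A ᶜ[ E G ]) (θ₁ G))
                    (nIso G + isolatedBy G (A ᶜ[ E G ]))

-- Partial dual: on the flags of edges in A the roles of θ₀ and θ₂ are
-- exchanged; we realise this by swapping the end/side coordinates.

tr : ∀ {m} → EdgeSet m → Flag m → Flag m
tr A (e , a , b) = if A e then (e , b , a) else (e , a , b)

_^_ : (G : RibbonGraph) → EdgeSet (m G) → RibbonGraph
G ^ A = ribbonGraph (m G) (E G) (tr A ∘ θ₁ G ∘ tr A) (nIso G)

-- e and f are joined by a path in G|_B (through vertices of G and edges of B)
ConnIn : (G : RibbonGraph) → EdgeSet (m G) → Fin (m G) → Fin (m G) → Set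
ConnIn G B e f = T (Reach G (θ₁ G ∷ θ₂ ∷ σ ∷ []) (e , false , false) (f , false , false))
  where
  σ : Flag (m G) → Flag (m G)
  σ x = if B (edgeOf x) then θ₀ x else x

IsComponent : (G : RibbonGraph) → EdgeSet (m G) → EdgeSet (m G) → Set
IsComponent G B H =
  (∃ λ e → T (H e)) ×
  (∀ e → T (H e) → T (B e)) ×
  (∀ e f → T (H e) → T (B f) → (T (H f) ⇔ ConnIn G B e f))

commonVertices : (G : RibbonGraph) → EdgeSet (m G) → EdgeSet (m G) → ℕ
commonVertices G S S' = countClasses (RV G)
  (λ x → any (λ y → RV G x y ∧ S (edgeOf y)) (flags G)
       ∧ any (λ y → RV G x y ∧ S' (edgeOf y)) (flags G)) (flags G)

-- A sequence of 1-sums H₀ ⊕ H₁ ⊕ ⋯ ⊕ H_{l-1} whose summands are exactly the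
-- components of G|_A (tag true) and of G|_{Aᶜ} (tag false), each exactly once,
-- such that at step i the ribbon subgraph H₀ ∪ ⋯ ∪ H_{i-1} meets H_i in exactly
-- one vertex, and this 1-sum involves a component of G|_A and one of G|_{Aᶜ}.
record OneSumDecomposition (G : RibbonGraph) (A : EdgeSet (m G)) : Set where
  field
    l   : ℕ
    tag : Fin l → Bool
    H   : Fin l → EdgeSet (m G)
    summands-are-components : ∀ i →
      IsComponent G (if tag i then (E G ∩ₑ A) else (A ᶜ[ E G ])) (H i)
    distinct : ∀ i j → i ≢ j → ∀ e → ¬ (T (H i e) × T (H j e))
    cover    : ∀ e → T (E G e) → ∃ λ i → T (H i e)
    one-sum  : ∀ i → 0 < toℕ i →
      commonVertices G (λ e → any (λ j → (toℕ j <ᵇ toℕ i) ∧ H j e) (allFin l)) (H i) ≡ 1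
    mixed    : ∀ i → 0 < toℕ i →
      ∃ λ j → (toℕ j < toℕ i) × (tag j ≢ tag i) × (1 ≤ commonVertices G (H j) (H i))

Biseparation : (G : RibbonGraph) → EdgeSet (m G) → Set
Biseparation G A =
  (∀ e → T (E G e) → T (A e)) ⊎ (∀ e → ¬ T (A e)) ⊎ OneSumDecomposition G A

{-# OPTIONS --safe #-}
module Submission where

-- For S ⊆ E(G) let k(S) and f(S) count the components and the boundary
-- components of the spanning subgraph (V(G), S), and put B = E(G) \ A.  The
-- partial dual has f(A) vertices and f(B) faces, so Euler's formula turns the
-- genus equation into k(A) + k(B) = v + 1: the bipartite graph whose nodes are
-- the components of both sides and whose edges are the vertices of G is a tree.
-- Dropping the isolated vertices of either side, this says that the number of
-- components of G|_A and G|_B exceeds by one the number d of vertices meeting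
-- both A and B.  For every ordering H₀, H₁, … of these components, d is the sum
-- over i of the number of vertices that Hᵢ shares with H₀ ∪ ⋯ ∪ Hᵢ₋₁, and as G
-- is connected some ordering makes all these terms with i > 0 positive.
--
-- Partial duality only exchanges θ₀ and θ₂ on A, so it preserves bipartiteness
-- of the gem; colourings of the Hᵢ glue along single shared vertices, after
-- flipping a colour if necessary.

open import Defs
open import Algebra.Bundles using (AbelianGroup)
open import Data.Bool using (Bool; true; false; not; _∧_; _xor_; if_then_else_; T)
open import Data.Bool.ListAction using (any)
open import Data.Bool.Properties using (T-∧; T-≡; T-not-≡; T?; not-involutive; ¬-not; not-¬) renaming (_≟_ to _≟ᵇ_)
open import Data.Empty using (⊥-elim)
open import Data.Fin using (Fin; zero; suc; toℕ; fromℕ<)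
open import Data.Fin.Properties using (injective⇒≤; pigeonhole; toℕ≤pred[n]; toℕ-injective; toℕ-fromℕ<; toℕ<n) renaming (_≟_ to _≟ᶠ_)
open import Data.Integer using (ℤ) renaming (+_ to pos; _+_ to _+ℤ_; _-_ to _-ℤ_)
import Data.Integer.Properties as ℤ
open import Algebra.Properties.Group (AbelianGroup.group ℤ.+-0-abelianGroup) using (identityʳ-unique)
open import Data.Integer.Solver using (module +-*-Solver)
open import Data.List using (List; []; _∷_; _++_; map; length; lookup; tabulate; filterᵇ; concatMap; allFin)
open import Data.List.Membership.Propositional using (_∈_; lose; find)
open import Data.List.Membership.Propositional.Properties using (∈-++⁺ˡ; ∈-++⁺ʳ; ∈-++⁻; ∈-concatMap⁺; ∈-concatMap⁻; ∈-map⁺; ∈-map⁻; ∈-lookup; ∈-allFin; ∈-filter⁺; ∈-filter⁻; ∈-∃++)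
open import Data.List.Properties using (length-++; length-map; length-++-≤ˡ; length-tabulate)
open import Data.List.Relation.Binary.Permutation.Propositional using (_↭_; prep; swap; ↭-refl; ↭-sym; ↭-trans; ↭-reflexive)
open import Data.List.Relation.Binary.Permutation.Propositional.Properties using (All-resp-↭; Any-resp-↭; ↭-length; shift; ++⁺ˡ)
open import Data.List.Relation.Unary.All as All using (All; []; _∷_)
import Data.List.Relation.Unary.All.Properties as All
open import Data.List.Relation.Unary.AllPairs using (AllPairs; []; _∷_)
import Data.List.Relation.Unary.AllPairs.Properties as AllPairs
open import Data.List.Relation.Unary.Any as Any using (Any; here; there; index)
import Data.List.Relation.Unary.Any.Properties as Any
open import Data.Nat using (ℕ; zero; suc; pred; _+_; _*_; _≤_; _<_; _<ᵇ_; z≤n; s≤s)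
open import Data.Nat.Properties
import Data.Nat.Solver
open import Data.Product using (Σ; ∃; _×_; _,_; proj₁; proj₂)
open import Data.Sum using (_⊎_; inj₁; inj₂)
open import Data.Unit using (⊤; tt)
open import Function using (_∘_; id; _∋_)
open import Function.Bundles using (_⇔_; mk⇔; Equivalence)
open import Relation.Binary.Construct.Closure.ReflexiveTransitive as Star using (Star; ε; _◅_; _◅◅_)
open import Relation.Binary.Definitions using (Reflexive; Symmetric; Transitive)
open import Relation.Binary.PropositionalEquality
open import Relation.Nullary using (¬_; Dec; yes; no; contradiction)
open import Relation.Nullary.Decidable using (toWitness; fromWitness)

-- Transversals

-- Every count in the definitions is the output of a list program, and two such outputs are not
-- directly comparable. Each is therefore certified by a transversal, `HasClasses R P n`, and all
-- relations are brought to the flags of the one graph `G`: flag maps and splittings of the flags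
-- carry transversals along, and `classes-unique` turns two transversals of one relation into an
-- equation of numbers. The obstacle is that a subgraph has fewer flags and rotates by `skip`, which
-- jumps over deleted half-edges and loses every vertex left without edges; so each of its orbit
-- counts has to be completed by the number of vertices that it isolates. The tree itself is never
-- built. Only its numerical trace is used: l - 1 positive terms whose sum is at most l - 1 are all
-- equal to 1. Euler's formula yields twice the excess of components, which is why the genus
-- equation ends with a halving in the integers.

record HasClasses {X : Set} (R : X → X → Set) (P : X → Set) (n : ℕ) : Set where
  field
    reps  : List X
    size  : length reps ≡ n
    inP   : All P reps
    apart : AllPairs (λ x y → ¬ R x y) reps
    cover : ∀ {x} → P x → Any (R x) reps

open HasClasses

apart⇒lookup-injective : ∀ {X : Set} {R : X → X → Set} → Symmetric R → ∀ {xs} →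
  AllPairs (λ x y → ¬ R x y) xs → ∀ i j → R (lookup xs i) (lookup xs j) → i ≡ j
apart⇒lookup-injective sm (_ ∷ ap) zero zero r = refl
apart⇒lookup-injective sm (h ∷ ap) zero (suc j) r = contradiction r (All.lookup h (∈-lookup j))
apart⇒lookup-injective sm (h ∷ ap) (suc i) zero r = contradiction (sm r) (All.lookup h (∈-lookup i))
apart⇒lookup-injective sm (_ ∷ ap) (suc i) (suc j) r = cong suc (apart⇒lookup-injective sm ap i j r)

-- Sending each `x` to the position of an `S`-partner is injective, because entries with a common
-- partner are `R`-related. It serves for two transversals of one relation and for lists without
-- repetition.
apart⇒length≤ : ∀ {X Y : Set} {R : X → X → Set} {S : X → Y → Set} → Symmetric R →
  (∀ {x x' y} → S x y → S x' y → R x x') → ∀ {xs ys} →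
  AllPairs (λ x y → ¬ R x y) xs → (∀ {x} → x ∈ xs → Any (S x) ys) → length xs ≤ length ys
apart⇒length≤ {R = R} {S} sm joint {xs} {ys} ap cov = injective⇒≤ {f = f} f-inj
  where
  f : Fin (length xs) → Fin (length ys)
  f i = index (cov (∈-lookup i))
  f-inj : ∀ {i j} → f i ≡ f j → i ≡ j
  f-inj {i} {j} eq = apart⇒lookup-injective sm ap i j
    (joint (Any.lookup-index (cov (∈-lookup i)))
           (subst (S (lookup xs j) ∘ lookup ys) (sym eq) (Any.lookup-index (cov (∈-lookup j)))))

module _ {X : Set} {R : X → X → Set} {P : X → Set} (sm : Symmetric R) (tr : Transitive R) where

  classes-≤ : ∀ {m n} → HasClasses R P m → HasClasses R P n → m ≤ n
  classes-≤ h k = subst₂ _≤_ (size h) (size k)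
    (apart⇒length≤ sm (λ r s → tr r (sm s)) (apart h) (λ x∈ → cover k (All.lookup (inP h) x∈)))

  classes-unique : ∀ {m n} → HasClasses R P m → HasClasses R P n → m ≡ n
  classes-unique h k = ≤-antisym (classes-≤ h k) (classes-≤ k h)

apart-weaken : ∀ {X : Set} {Q : X → Set} {R S : X → X → Set} →
  (∀ {x y} → Q x → Q y → S x y → R x y) → ∀ {xs} → All Q xs →
  AllPairs (λ x y → ¬ R x y) xs → AllPairs (λ x y → ¬ S x y) xs
apart-weaken f [] [] = []
apart-weaken f (q ∷ qs) (a ∷ as) = All.zipWith (λ (q' , nr) s → nr (f q q' s)) (qs , a) ∷ apart-weaken f qs as

classes-map : ∀ {X Y : Set} {R : X → X → Set} {P : X → Set} {R' : Y → Y → Set} {Q : Y → Set} {n} →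
  (f : X → Y) → Transitive R' → (∀ {x} → P x → Q (f x)) →
  (∀ {x y} → R x y → R' (f x) (f y)) → (∀ {x y} → P x → P y → R' (f x) (f y) → R x y) →
  (∀ {y} → Q y → ∃ λ x → P x × R' y (f x)) → HasClasses R P n → HasClasses R' Q n
classes-map f tr PQ fwd bwd onto h = record
  { reps = map f (reps h)
  ; size = trans (length-map f (reps h)) (size h)
  ; inP = All.map⁺ (All.map PQ (inP h))
  ; apart = AllPairs.map⁺ (apart-weaken bwd (inP h) (apart h))
  ; cover = λ q → let x , p , r = onto q in Any.map⁺ (Any.map (λ s → tr r (fwd s)) (cover h p))
  }

classes-⇔ : ∀ {X : Set} {R R' : X → X → Set} {P : X → Set} {n} → Transitive R' → Reflexive R' →
  (∀ {x y} → R x y → R' x y) → (∀ {x y} → P x → R' x y → R x y) → HasClasses R P n → HasClasses R' P n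
classes-⇔ tr rf fwd bwd = classes-map id tr id fwd (λ p _ → bwd p) (λ {y} q → y , q , rf)

-- Each part brings its own relation, which has to agree with `R` on that part only. Thus orbits
-- under the generators of a subgraph and vertex orbits of `G` can add up to orbits of a third kind.
classes-⊎ : ∀ {X : Set} {R₁ R₂ R : X → X → Set} {P₁ P₂ P : X → Set} {n₁ n₂} → Transitive R →
  (∀ {x} → P₁ x → P x) → (∀ {x} → P₂ x → P x) →
  (∀ {x y} → P₁ x → P₁ y → R x y → R₁ x y) → (∀ {x y} → P₂ x → P₂ y → R x y → R₂ x y) →
  (∀ {x y} → P₁ x → P₂ y → ¬ R x y) →
  (∀ {x y} → P₁ x → R₁ x y → R x y) → (∀ {x y} → P₂ x → R₂ x y → R x y) →
  (∀ {x} → P x → (∃ λ z → P₁ z × R x z) ⊎ (∃ λ z → P₂ z × R x z)) →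
  HasClasses R₁ P₁ n₁ → HasClasses R₂ P₂ n₂ → HasClasses R P (n₁ + n₂)
classes-⊎ {R = R} {P = P} tr in₁ in₂ r₁ r₂ disj s₁ s₂ split h k = record
  { reps = reps h ++ reps k
  ; size = trans (length-++ (reps h)) (cong₂ _+_ (size h) (size k))
  ; inP = All.++⁺ (All.map in₁ (inP h)) (All.map in₂ (inP k))
  ; apart = AllPairs.++⁺ (apart-weaken r₁ (inP h) (apart h)) (apart-weaken r₂ (inP k) (apart k))
      (All.map (λ p → All.map (disj p) (inP k)) (inP h))
  ; cover = cov
  }
  where
  cov : ∀ {x} → P x → Any (R x) (reps h ++ reps k)
  cov p with split p
  ... | inj₁ (z , pz , r) = Any.++⁺ˡ (Any.map (λ s → tr r (s₁ pz s)) (cover h pz))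
  ... | inj₂ (z , pz , r) = Any.++⁺ʳ (reps h) (Any.map (λ s → tr r (s₂ pz s)) (cover k pz))

classes-P : ∀ {X : Set} {R : X → X → Set} {P Q : X → Set} {n} →
  (∀ {x} → P x → Q x) → (∀ {x} → Q x → P x) → HasClasses R P n → HasClasses R Q n
classes-P to from h = record
  { reps = reps h ; size = size h ; inP = All.map to (inP h) ; apart = apart h ; cover = cover h ∘ from }

classes-empty : ∀ {X : Set} {R : X → X → Set} {P : X → Set} → (∀ {x} → ¬ P x) → HasClasses R P 0
classes-empty none = record { reps = [] ; size = refl ; inP = [] ; apart = [] ; cover = ⊥-elim ∘ none }

classes-empty⁻ : ∀ {X : Set} {R : X → X → Set} {P : X → Set} {n} → (∀ {x} → ¬ P x) → HasClasses R P n → n ≡ 0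
classes-empty⁻ none h with reps h | size h | inP h
... | []    | s | _       = sym s
... | _ ∷ _ | _ | p ∷ _ = ⊥-elim (none p)

classes-nonempty : ∀ {X : Set} {R : X → X → Set} {P : X → Set} {n x} → P x → HasClasses R P n → 1 ≤ n
classes-nonempty p h with reps h | size h | cover h p
... | _ ∷ _ | refl | _ = s≤s z≤n

classes-single : ∀ {X : Set} {R : X → X → Set} {P : X → Set} {n} → Symmetric R → Transitive R → n ≤ 1 →
  HasClasses R P n → ∀ {x y} → P x → P y → R x y
classes-single sm tr n≤1 h p q with reps h | size h | cover h p | cover h q
... | _ ∷ []    | _ | here r | here s = tr r (sm s)
... | _ ∷ _ ∷ _ | refl | _ | _ = contradiction n≤1 λ { (s≤s ()) }

classes-witness : ∀ {X : Set} {R : X → X → Set} {P : X → Set} {n} → 1 ≤ n → HasClasses R P n → ∃ P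
classes-witness le h with reps h | size h | inP h
... | x ∷ _ | _ | p ∷ _ = x , p
... | [] | refl | _ = contradiction le λ ()

apart-resp-↭ : ∀ {X : Set} {R : X → X → Set} → Symmetric R → ∀ {xs ys} → xs ↭ ys →
  AllPairs (λ x y → ¬ R x y) xs → AllPairs (λ x y → ¬ R x y) ys
apart-resp-↭ sm _↭_.refl ap = ap
apart-resp-↭ sm (prep x p) (a ∷ ap) = All-resp-↭ p a ∷ apart-resp-↭ sm p ap
apart-resp-↭ sm (swap x y p) ((n ∷ a) ∷ b ∷ ap) = ((n ∘ sm) ∷ All-resp-↭ p b) ∷ All-resp-↭ p a ∷ apart-resp-↭ sm p ap
apart-resp-↭ sm (_↭_.trans p q) ap = apart-resp-↭ sm q (apart-resp-↭ sm p ap)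

-- Greedy class counting

module _ {X : Set} (R : X → X → Bool) (P : X → Bool) where
  countFrom : List X → List X → ℕ
  countFrom seen []       = 0
  countFrom seen (x ∷ xs) =
    (if any (R x) seen then 0 else (if P x then 1 else 0)) + countFrom (x ∷ seen) xs

-- The `go` of countClasses has no name outside its definition; the
-- placeholder below is solved to it by unification.
mutual
  go≡countFrom : ∀ {X : Set} (R : X → X → Bool) (P : X → Bool) (seen xs : List X) → _ ≡ countFrom R P seen xs

  countClasses-∷ : ∀ {X : Set} (R : X → X → Bool) (P : X → Bool) x xs →
    countClasses R P (x ∷ xs) ≡ countFrom R P [] (x ∷ xs)
  -- Turning `x ∷ []` into a variable leaves the placeholder applied to variables only, so that
  -- unification can solve it.
  countClasses-∷ {X} R P x xs with List X ∋ x ∷ []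
  ... | seen = cong ((if P x then 1 else 0) +_) (go≡countFrom R P seen xs)

  go≡countFrom R P seen [] = refl
  go≡countFrom R P seen (x ∷ xs) =
    cong ((if any (R x) seen then 0 else (if P x then 1 else 0)) +_) (go≡countFrom R P (x ∷ seen) xs)

countClasses≡countFrom : ∀ {X : Set} (R : X → X → Bool) (P : X → Bool) xs →
  countClasses R P xs ≡ countFrom R P [] xs
countClasses≡countFrom R P []       = refl
countClasses≡countFrom R P (x ∷ xs) = countClasses-∷ R P x xs

module _ {X : Set} {R : X → X → Bool} {P : X → Bool} {R̂ : X → X → Set} {M P̂ : X → Set}
  (rf : Reflexive R̂) (sm : Symmetric R̂) (tr : Transitive R̂)
  (R⇔ : ∀ {x y} → M x → T (R x y) ⇔ R̂ x y) (P⇔ : ∀ {x} → M x → T (P x) ⇔ P̂ x)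
  (P̂-resp : ∀ {x y} → R̂ x y → P̂ x → P̂ y) where

  private
    -- The invariant of the scan. The list `seen` also holds entries that fail `P`; an entry related
    -- to one of them fails `P̂` too, since `P̂` is constant on classes, so no class is lost.
    record Partial (seen xs : List X) (n : ℕ) : Set where
      field
        reps'  : List X
        size'  : length reps' ≡ n
        inP'   : All (λ x → M x × P̂ x) reps'
        apart' : AllPairs (λ x y → ¬ R̂ x y) reps'
        fresh' : All (λ x → All (λ s → ¬ R̂ x s) seen) reps'
        cover' : ∀ {x} → x ∈ xs → P̂ x → Any (R̂ x) reps' ⊎ Any (R̂ x) seen
    open Partial

    partials : ∀ seen xs → All M xs → Partial seen xs (countFrom R P seen xs)
    partials seen [] [] = record
      { reps' = [] ; size' = refl ; inP' = [] ; apart' = [] ; fresh' = [] ; cover' = λ () }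
    partials seen (x ∷ xs) (mx ∷ ms) with any (R x) seen in eq | P x in eqP | partials (x ∷ seen) xs ms
    ... | true | _ | h = record
      { reps' = reps' h ; size' = size' h ; inP' = inP' h ; apart' = apart' h
      ; fresh' = All.map All.tail (fresh' h) ; cover' = cov }
      where
      old : Any (R̂ x) seen
      old = Any.map (Equivalence.to (R⇔ mx)) (Any.any⁻ (R x) seen (Equivalence.from T-≡ eq))
      cov : ∀ {y} → y ∈ x ∷ xs → P̂ y → Any (R̂ y) (reps' h) ⊎ Any (R̂ y) seen
      cov (here refl) p = inj₂ old
      cov (there y∈) p with cover' h y∈ p
      ... | inj₁ a = inj₁ a
      ... | inj₂ (here r) = inj₂ (Any.map (tr r) old)
      ... | inj₂ (there a) = inj₂ a
    ... | false | true | h = record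
      { reps' = x ∷ reps' h ; size' = cong suc (size' h)
      ; inP' = (mx , Equivalence.to (P⇔ mx) (Equivalence.from T-≡ eqP)) ∷ inP' h
      ; apart' = All.map (λ f r → All.head f (sm r)) (fresh' h) ∷ apart' h
      ; fresh' = All.tabulate (λ s∈ r → subst T eq (Any.any⁺ (R x) (lose s∈ (Equivalence.from (R⇔ mx) r))))
                 ∷ All.map All.tail (fresh' h)
      ; cover' = cov }
      where
      cov : ∀ {y} → y ∈ x ∷ xs → P̂ y → Any (R̂ y) (x ∷ reps' h) ⊎ Any (R̂ y) seen
      cov (here refl) p = inj₁ (here rf)
      cov (there y∈) p with cover' h y∈ p
      ... | inj₁ a = inj₁ (there a)
      ... | inj₂ (here r) = inj₁ (here r)
      ... | inj₂ (there a) = inj₂ a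
    ... | false | false | h = record
      { reps' = reps' h ; size' = size' h ; inP' = inP' h ; apart' = apart' h
      ; fresh' = All.map All.tail (fresh' h) ; cover' = cov }
      where
      ¬Px : ¬ P̂ x
      ¬Px p = subst T eqP (Equivalence.from (P⇔ mx) p)
      cov : ∀ {y} → y ∈ x ∷ xs → P̂ y → Any (R̂ y) (reps' h) ⊎ Any (R̂ y) seen
      cov (here refl) p = contradiction p ¬Px
      cov (there y∈) p with cover' h y∈ p
      ... | inj₁ a = inj₁ a
      ... | inj₂ (here r) = contradiction (P̂-resp r p) ¬Px
      ... | inj₂ (there a) = inj₂ a

  countClasses-classes : ∀ {xs} → All M xs → (∀ {x} → M x → x ∈ xs) →
    HasClasses R̂ (λ x → M x × P̂ x) (countClasses R P xs)
  countClasses-classes {xs} ms compl = record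
    { reps = reps' h ; size = trans (size' h) (sym (countClasses≡countFrom R P xs))
    ; inP = inP' h ; apart = apart' h ; cover = cov }
    where
    h = partials [] xs ms
    cov : ∀ {x} → M x × P̂ x → Any (R̂ x) (reps' h)
    cov (m , p) with cover' h (compl m) p
    ... | inj₁ a = a

-- Orbits

-- Every step starts in `P`: a well-formed `θ₁` is constrained on the flags of present edges only,
-- so symmetry of orbits can be had only there.
Orb : {X : Set} → (X → Set) → List (X → X) → X → X → Set
Orb P gs = Star (λ x y → P x × Any (λ g → g x ≡ y) gs)

InvolutionOn : {X : Set} → (X → Set) → (X → X) → Set
InvolutionOn P g = ∀ {x} → P x → P (g x) × g (g x) ≡ x

pick : ∀ {X : Set} {Q S : X → Set} {xs : List X} → All Q xs → Any S xs → ∃ λ x → Q x × S x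
pick (q ∷ _)  (here s)  = _ , q , s
pick (_ ∷ qs) (there a) = pick qs a

module _ {X : Set} {P : X → Set} {gs : List (X → X)} where

  orb-step : ∀ {g} → g ∈ gs → ∀ {x} → P x → Orb P gs x (g x)
  orb-step g∈ p = (p , Any.map (λ { refl → refl }) g∈) ◅ ε

  orb-closed : All (InvolutionOn P) gs → ∀ {x y} → Orb P gs x y → P x → P y
  orb-closed inv ε p = p
  orb-closed inv ((p , a) ◅ s) _ with pick inv a
  ... | _ , i , refl = orb-closed inv s (proj₁ (i p))

  orb-sym : All (InvolutionOn P) gs → Symmetric (Orb P gs)
  orb-sym inv = Star.reverse flip
    where
    flip : ∀ {x y} → P x × Any (λ g → g x ≡ y) gs → P y × Any (λ g → g y ≡ x) gs
    flip {x} (p , a) = lemma inv a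
      where
      lemma : ∀ {hs y} → All (InvolutionOn P) hs → Any (λ g → g x ≡ y) hs → P y × Any (λ g → g y ≡ x) hs
      lemma (i ∷ _) (here refl) = proj₁ (i p) , here (proj₂ (i p))
      lemma (_ ∷ is) (there a) = let q , b = lemma is a in q , there b

  orb-gmap : ∀ {Y : Set} {R : Y → Y → Set} (f : X → Y) → Reflexive R → Transitive R →
    All (λ g → ∀ {x} → P x → R (f x) (f (g x))) gs → ∀ {x y} → Orb P gs x y → R (f x) (f y)
  orb-gmap {R = R} f rf tr hs ε = rf
  orb-gmap {R = R} f rf tr hs ((p , a) ◅ s) with pick hs a
  ... | _ , h , refl = tr (h p) (orb-gmap {R = R} f rf tr hs s)

  orb-⊆ : ∀ {R : X → X → Set} → Reflexive R → Transitive R →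
    All (λ g → ∀ {x} → P x → R x (g x)) gs → ∀ {x y} → Orb P gs x y → R x y
  orb-⊆ {R} = orb-gmap {R = R} id

-- Reachability

module _ {X : Set} (eq : X → X → Bool) where
  adjoin : List X → List X → List X
  adjoin acc []       = acc
  adjoin acc (y ∷ ys) = if any (eq y) acc then adjoin acc ys else adjoin (acc ++ (y ∷ [])) ys

successors : {X : Set} → List (X → X) → List X → List X
successors gs = concatMap (λ x → map (λ g → g x) gs)

-- As for countClasses; the generators and the set are given in cons form so
-- that addAll unfolds to an instance with a generic accumulator.
mutual
  addAll≡adjoin : ∀ {X : Set} (k : ℕ) (g : X → X) (gs : List (X → X)) (eq : X → X → Bool)
    (x : X) (S acc ys : List X) → _ ≡ adjoin eq acc ys

  closeIn-suc : ∀ {X : Set} (k : ℕ) (g : X → X) (gs : List (X → X)) (eq : X → X → Bool) (x : X) (S : List X) →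
    closeIn (suc k) (g ∷ gs) eq (x ∷ S)
    ≡ closeIn k (g ∷ gs) eq (adjoin eq (x ∷ S) (successors (g ∷ gs) (x ∷ S)))
  closeIn-suc {X} k g gs eq x S
    with any (eq (g x)) (x ∷ S) | List X ∋ x ∷ S ++ (g x ∷ []) | List X ∋ map (λ h → h x) gs ++ successors (g ∷ gs) S
  ... | false | acc | ys = cong (closeIn k (g ∷ gs) eq) (addAll≡adjoin k g gs eq x S acc ys)
  ... | true  | acc | ys = cong (closeIn k (g ∷ gs) eq) (addAll≡adjoin k g gs eq x S (x ∷ S) ys)

  addAll≡adjoin k g gs eq x S acc [] = refl
  addAll≡adjoin k g gs eq x S acc (y ∷ ys) with any (eq y) acc
  ... | true  = addAll≡adjoin k g gs eq x S acc ys
  ... | false = addAll≡adjoin k g gs eq x S (acc ++ (y ∷ [])) ys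

Distinct : {X : Set} → List X → Set
Distinct = AllPairs (λ x y → ¬ x ≡ y)

distinct⊆⇒length≤ : ∀ {X : Set} {xs ys : List X} → Distinct xs → (∀ {x} → x ∈ xs → x ∈ ys) → length xs ≤ length ys
distinct⊆⇒length≤ = apart⇒length≤ sym (λ { refl refl → refl })

Closed : {X : Set} → List (X → X) → List X → Set
Closed gs S = ∀ {x} → x ∈ S → ∀ {g} → g ∈ gs → g x ∈ S

successors-⊆ : ∀ {X : Set} (gs : List (X → X)) (S : List X) {z} → z ∈ successors gs S →
  ∃ λ x → x ∈ S × ∃ λ g → g ∈ gs × z ≡ g x
successors-⊆ gs S z∈ =
  let x , x∈ , z∈' = find (∈-concatMap⁻ (λ x → map (λ g → g x) gs) {xs = S} z∈) in x , x∈ , ∈-map⁻ (λ g → g x) z∈'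

successors-⊇ : ∀ {X : Set} {gs : List (X → X)} {S x g} → x ∈ S → g ∈ gs → g x ∈ successors gs S
successors-⊇ x∈ g∈ = ∈-concatMap⁺ _ (lose x∈ (∈-map⁺ (λ h → h _) g∈))

module _ {X : Set} {eq : X → X → Bool} (eq⇔ : ∀ {x y} → T (eq x y) ⇔ x ≡ y) where

  any-eq⁻ : ∀ {y xs} → T (any (eq y) xs) → y ∈ xs
  any-eq⁻ {y} {xs} t = Any.map (Equivalence.to eq⇔) (Any.any⁻ (eq y) xs t)

  any-eq⁺ : ∀ {y xs} → y ∈ xs → T (any (eq y) xs)
  any-eq⁺ {y} y∈ = Any.any⁺ (eq y) (Any.map (Equivalence.from eq⇔) y∈)

  adjoin-⊇ˡ : ∀ {acc} ys {z} → z ∈ acc → z ∈ adjoin eq acc ys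
  adjoin-⊇ˡ [] z∈ = z∈
  adjoin-⊇ˡ {acc} (y ∷ ys) z∈ with any (eq y) acc
  ... | true  = adjoin-⊇ˡ ys z∈
  ... | false = adjoin-⊇ˡ ys (∈-++⁺ˡ z∈)

  adjoin-⊇ʳ : ∀ {acc ys z} → z ∈ ys → z ∈ adjoin eq acc ys
  adjoin-⊇ʳ {acc} {y ∷ ys} z∈ with any (eq y) acc in e
  adjoin-⊇ʳ {acc} {y ∷ ys} (here refl) | true  = adjoin-⊇ˡ ys (any-eq⁻ (Equivalence.from T-≡ e))
  adjoin-⊇ʳ {acc} {y ∷ ys} (here refl) | false = adjoin-⊇ˡ ys (∈-++⁺ʳ acc (here refl))
  adjoin-⊇ʳ {acc} {y ∷ ys} (there z∈) | true  = adjoin-⊇ʳ z∈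
  adjoin-⊇ʳ {acc} {y ∷ ys} (there z∈) | false = adjoin-⊇ʳ z∈

  adjoin-⊆ : ∀ {acc} ys {z} → z ∈ adjoin eq acc ys → z ∈ acc ⊎ z ∈ ys
  adjoin-⊆ [] z∈ = inj₁ z∈
  adjoin-⊆ {acc} (y ∷ ys) z∈ with any (eq y) acc
  ... | true with adjoin-⊆ ys z∈
  ...   | inj₁ a = inj₁ a
  ...   | inj₂ b = inj₂ (there b)
  adjoin-⊆ {acc} (y ∷ ys) z∈ | false with adjoin-⊆ ys z∈
  ...   | inj₂ b = inj₂ (there b)
  ...   | inj₁ a with ∈-++⁻ acc a
  ...     | inj₁ c = inj₁ c
  ...     | inj₂ (here refl) = inj₂ (here refl)

  adjoin-distinct : ∀ {acc} ys → Distinct acc → Distinct (adjoin eq acc ys)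
  adjoin-distinct [] d = d
  adjoin-distinct {acc} (y ∷ ys) d with any (eq y) acc in e
  ... | true  = adjoin-distinct ys d
  ... | false = adjoin-distinct ys (AllPairs.++⁺ d ([] ∷ [])
    (All.tabulate (λ {z} z∈ → (λ { refl → subst T e (any-eq⁺ z∈) }) ∷ [])))

  adjoin-length : ∀ {acc} ys → length acc ≤ length (adjoin eq acc ys)
  adjoin-length [] = ≤-refl
  adjoin-length {acc} (y ∷ ys) with any (eq y) acc
  ... | true  = adjoin-length ys
  ... | false = ≤-trans (length-++-≤ˡ acc) (adjoin-length ys)

  adjoin-stable : ∀ {acc} ys → (∀ {y} → y ∈ ys → y ∈ acc) ⊎ length acc < length (adjoin eq acc ys)
  adjoin-stable [] = inj₁ λ ()
  adjoin-stable {acc} (y ∷ ys) with any (eq y) acc in e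
  ... | false = inj₂ (≤-trans (≤-reflexive (trans (+-comm 1 _) (sym (length-++ acc)))) (adjoin-length ys))
  ... | true with adjoin-stable {acc} ys
  ...   | inj₁ f = inj₁ λ { (here refl) → any-eq⁻ (Equivalence.from T-≡ e) ; (there y∈) → f y∈ }
  ...   | inj₂ l = inj₂ l

  module _ {P : X → Set} {g : X → X} {gs : List (X → X)} (inv : All (InvolutionOn P) (g ∷ gs))
    {all : List X} (complete : ∀ {x} → P x → x ∈ all) where

    adjoin-closed : ∀ {S} → Closed (g ∷ gs) S → Closed (g ∷ gs) (adjoin eq S (successors (g ∷ gs) S))
    adjoin-closed {S} cl z∈ h∈ with adjoin-⊆ (successors (g ∷ gs) S) z∈
    ... | inj₁ z∈S = adjoin-⊇ˡ (successors (g ∷ gs) S) (cl z∈S h∈)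
    ... | inj₂ z∈s with successors-⊆ (g ∷ gs) S z∈s
    ...   | x , x∈ , h' , h'∈ , refl = adjoin-⊇ˡ (successors (g ∷ gs) S) (cl (cl x∈ h'∈) h∈)

    closeIn-closed⁺ : ∀ k {S} → Closed (g ∷ gs) S → Closed (g ∷ gs) (closeIn k (g ∷ gs) eq S)
    closeIn-closed⁺ zero cl = cl
    closeIn-closed⁺ (suc k) {[]} cl = closeIn-closed⁺ k {[]} cl
    closeIn-closed⁺ (suc k) {x ∷ S} cl = subst (Closed (g ∷ gs)) (sym (closeIn-suc k g gs eq x S))
      (closeIn-closed⁺ k (adjoin-closed cl))

    adjoin-inside : ∀ {S} → (∀ {x} → x ∈ S → P x) → ∀ {x} → x ∈ adjoin eq S (successors (g ∷ gs) S) → P x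
    adjoin-inside {S} ins z∈ with adjoin-⊆ (successors (g ∷ gs) S) z∈
    ... | inj₁ z∈S = ins z∈S
    ... | inj₂ z∈s with successors-⊆ (g ∷ gs) S z∈s
    ...   | x , x∈ , h' , h'∈ , refl = proj₁ (All.lookup inv h'∈ (ins x∈))

    -- Each round either enlarges the set or finds it already closed.
    closeIn-closed : ∀ k {S} → (∀ {x} → x ∈ S → P x) → Distinct S → length all ≤ length S + k →
      Closed (g ∷ gs) (closeIn k (g ∷ gs) eq S)
    closeIn-closed zero {S} ins d le {x} x∈ {h} h∈ with any (eq (h x)) S in e
    ... | true  = any-eq⁻ (Equivalence.from T-≡ e)
    -- Here `S` already has as many distinct entries as `all`, which leaves no room for a further
    -- element `h x` of `P`.
    ... | false = contradiction (≤-trans (distinct⊆⇒length≤ {xs = h x ∷ S}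
        (All.tabulate (λ { z∈ refl → subst T e (any-eq⁺ z∈) }) ∷ d)
        (λ { (here refl) → complete (proj₁ (All.lookup inv h∈ (ins x∈))) ; (there z∈) → complete (ins z∈) }))
        (≤-trans le (≤-reflexive (+-identityʳ _)))) (<-irrefl refl)
    closeIn-closed (suc k) {[]} ins d le = closeIn-closed⁺ k {[]} λ ()
    closeIn-closed (suc k) {x ∷ S} ins d le
      with adjoin-stable {x ∷ S} (successors (g ∷ gs) (x ∷ S))
    ... | inj₁ st = closeIn-closed⁺ (suc k) {x ∷ S} λ y∈ h∈ → st (successors-⊇ y∈ h∈)
    ... | inj₂ lt = subst (Closed (g ∷ gs)) (sym (closeIn-suc k g gs eq x S))
      (closeIn-closed k (adjoin-inside ins) (adjoin-distinct (successors (g ∷ gs) (x ∷ S)) d)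
        (≤-trans le (≤-trans (≤-reflexive (+-suc _ k)) (+-monoˡ-≤ k lt))))

    closeIn-⊇ : ∀ k {S z} → z ∈ S → z ∈ closeIn k (g ∷ gs) eq S
    closeIn-⊇ zero z∈ = z∈
    closeIn-⊇ (suc k) {x ∷ S} z∈ = subst (_ ∈_) (sym (closeIn-suc k g gs eq x S))
      (closeIn-⊇ k (adjoin-⊇ˡ (successors (g ∷ gs) (x ∷ S)) z∈))

    closeIn-sound : ∀ k {S z} → (∀ {x} → x ∈ S → P x) → z ∈ closeIn k (g ∷ gs) eq S →
      ∃ λ x → x ∈ S × Orb P (g ∷ gs) x z
    closeIn-sound zero ins z∈ = _ , z∈ , ε
    closeIn-sound (suc k) {[]} ins z∈ = closeIn-sound k {[]} ins z∈
    closeIn-sound (suc k) {x ∷ S} ins z∈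
      with closeIn-sound k (adjoin-inside ins) (subst (_ ∈_) (closeIn-suc k g gs eq x S) z∈)
    ... | y , y∈ , o with adjoin-⊆ (successors (g ∷ gs) (x ∷ S)) y∈
    ...   | inj₁ y∈S = y , y∈S , o
    ...   | inj₂ y∈s with successors-⊆ (g ∷ gs) (x ∷ S) y∈s
    ...     | w , w∈ , h , h∈ , refl = w , w∈ , orb-step h∈ (ins w∈) ◅◅ o

    closed⇒orb : ∀ {S} → Closed (g ∷ gs) S → ∀ {x y} → x ∈ S → Orb P (g ∷ gs) x y → y ∈ S
    closed⇒orb cl x∈ ε = x∈
    closed⇒orb cl x∈ ((_ , a) ◅ s) with find a
    ... | h , h∈ , refl = closed⇒orb cl (cl x∈ h∈) s

    reachIn⇔Orb : ∀ {x y} → P x → T (reachIn (length all) (g ∷ gs) eq x y) ⇔ Orb P (g ∷ gs) x y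
    reachIn⇔Orb {x} {y} p = mk⇔ to from
      where
      ins : ∀ {z} → z ∈ x ∷ [] → P z
      ins (here refl) = p
      to : T (reachIn (length all) (g ∷ gs) eq x y) → Orb P (g ∷ gs) x y
      to t with closeIn-sound (length all) ins (any-eq⁻ t)
      ... | _ , here refl , o = o
      from : Orb P (g ∷ gs) x y → T (reachIn (length all) (g ∷ gs) eq x y)
      -- The singleton counts as one entry, so `length all` rounds are one more than the bound asks
      -- for.
      from o = any-eq⁺ (closed⇒orb (closeIn-closed (length all) ins ([] ∷ []) (n≤1+n _))
        (closeIn-⊇ (length all) (here refl)) o)

-- Flags

==⇔≡ : ∀ {m} {x y : Flag m} → T (x == y) ⇔ x ≡ y
==⇔≡ {x = e , a , b} {y = e' , a' , b'} = mk⇔ to from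
  where
  to : T ((e , a , b) == (e' , a' , b')) → (e , a , b) ≡ (e' , a' , b')
  to t with Equivalence.to T-∧ t
  ... | t₁ , t' with Equivalence.to T-∧ t'
  ...   | t₂ , t₃ with toWitness {a? = e ≟ᶠ e'} t₁ | toWitness {a? = a ≟ᵇ a'} t₂ | toWitness {a? = b ≟ᵇ b'} t₃
  ...     | refl | refl | refl = refl
  from : (e , a , b) ≡ (e' , a' , b') → T ((e , a , b) == (e' , a' , b'))
  from refl = Equivalence.from T-∧ 
    (fromWitness {a? = e ≟ᶠ e} refl ,
     Equivalence.from T-∧ (fromWitness {a? = a ≟ᵇ a} refl , fromWitness {a? = b ≟ᵇ b} refl))

∈-allFlags : ∀ {m} (x : Flag m) → x ∈ allFlags m
∈-allFlags {m} (e , a , b) = ∈-concatMap⁺ _ (lose (∈-allFin e) (four a b))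
  where
  four : ∀ a b → (e , a , b) ∈ (e , false , false) ∷ (e , false , true) ∷ (e , true , false) ∷ (e , true , true) ∷ []
  four false false = here refl
  four false true  = there (here refl)
  four true  false = there (there (here refl))
  four true  true  = there (there (there (here refl)))

length-allFlags : ∀ m → length (allFlags m) ≡ 4 * m
length-allFlags m = trans (go (allFin m)) (cong (4 *_) (length-tabulate {n = m} id))
  where
  go : ∀ es → length (concatMap (λ e → (e , false , false) ∷ (e , false , true)
                            ∷ (e , true , false) ∷ (e , true , true) ∷ []) es) ≡ 4 * length es
  go [] = refl
  go (e ∷ es) = trans (cong (4 +_) (go es)) (sym (*-suc 4 (length es)))

∈-flags : ∀ G {x} → InE G x → x ∈ flags G
∈-flags G p = ∈-filter⁺ (T? ∘ E G ∘ edgeOf) (∈-allFlags _) p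

flags-InE : ∀ G → All (InE G) (flags G)
flags-InE G = All.tabulate (λ x∈ → proj₂ (∈-filter⁻ (T? ∘ E G ∘ edgeOf) {xs = allFlags _} x∈))

module _ (G : RibbonGraph) {g gs} (inv : All (InvolutionOn (InE G)) (g ∷ gs)) where

  Reach⇔Orb : ∀ {x y} → InE G x → T (Reach G (g ∷ gs) x y) ⇔ Orb (InE G) (g ∷ gs) x y
  Reach⇔Orb = reachIn⇔Orb ==⇔≡ inv (∈-flags G)

  countClasses-orbits : ∀ {P : Flag (m G) → Bool} {P̂ : Flag (m G) → Set} → (∀ {x} → InE G x → T (P x) ⇔ P̂ x) →
    (∀ {x y} → Orb (InE G) (g ∷ gs) x y → P̂ x → P̂ y) →
    HasClasses (Orb (InE G) (g ∷ gs)) (λ x → InE G x × P̂ x) (countClasses (Reach G (g ∷ gs)) P (flags G))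
  countClasses-orbits P⇔ resp = countClasses-classes ε (orb-sym inv) _◅◅_ Reach⇔Orb P⇔ resp (flags-InE G) (∈-flags G)

  countOrbits-classes : HasClasses (Orb (InE G) (g ∷ gs)) (InE G) (countOrbits G (g ∷ gs))
  countOrbits-classes = classes-P proj₁ (_, tt)
    (countClasses-orbits {P̂ = λ _ → ⊤} (λ _ → mk⇔ id id) (λ _ _ → tt))

θ₀-involutive : ∀ {m} (x : Flag m) → θ₀ (θ₀ x) ≡ x
θ₀-involutive (e , a , b) = cong (λ a' → e , a' , b) (not-involutive a)

θ₂-involutive : ∀ {m} (x : Flag m) → θ₂ (θ₂ x) ≡ x
θ₂-involutive (e , a , b) = cong (λ b' → e , a , b') (not-involutive b)

-- Walking around a vertex

module Vertices (G : RibbonGraph) (wf : WF G) where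
  open WF wf

  t : Flag (m G) → Flag (m G)
  t = θ₁ G

  t-inv : InvolutionOn (InE G) t
  t-inv p = θ₁-closed _ p , θ₁-invol _ p

  θ₂-inv : InvolutionOn (InE G) θ₂
  θ₂-inv p = p , θ₂-involutive _

  V-invs : All (InvolutionOn (InE G)) (t ∷ θ₂ ∷ [])
  V-invs = (λ {x} → t-inv {x}) ∷ (λ {x} → θ₂-inv {x}) ∷ []

  V : Flag (m G) → Flag (m G) → Set
  V = Orb (InE G) (t ∷ θ₂ ∷ [])

  V-sym : Symmetric V
  V-sym = orb-sym V-invs

  V-t : ∀ {x} → InE G x → V x (t x)
  V-t = orb-step (here refl)

  V-θ₂ : ∀ {x} → InE G x → V x (θ₂ x)
  V-θ₂ = orb-step (there (here refl))

  -- The vertex of `x` is incident with an edge in `S`. A predicate in place of a mask also allows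
  -- unions of summands such as `U n`.
  Touch : (Fin (m G) → Set) → Flag (m G) → Set
  Touch S x = ∃ λ y → V x y × S (edgeOf y)

  touch-resp : ∀ {S x y} → V x y → Touch S x → Touch S y
  touch-resp r (z , s , q) = z , V-sym r ◅◅ s , q

  touch-map : ∀ {S S' : Fin (m G) → Set} {x} → (∀ {e} → S e → S' e) → Touch S x → Touch S' x
  touch-map f (z , r , q) = z , r , f q

  touch-self : ∀ {S : Fin (m G) → Set} {x} → S (edgeOf x) → Touch S x
  touch-self {x = x} q = x , ε , q

  touch⇔ : ∀ {S : EdgeSet (m G)} {x} → InE G x →
    T (any (λ y → RV G x y ∧ S (edgeOf y)) (flags G)) ⇔ Touch (T ∘ S) x
  touch⇔ {S} {x} p = mk⇔ to from
    where
    to : T (any (λ y → RV G x y ∧ S (edgeOf y)) (flags G)) → Touch (T ∘ S) x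
    to h with find (Any.any⁻ (λ y → RV G x y ∧ S (edgeOf y)) (flags G) h)
    ... | y , _ , h' with Equivalence.to T-∧ h'
    ...   | r , q = y , Equivalence.to (Reach⇔Orb G V-invs p) r , q
    from : Touch (T ∘ S) x → T (any (λ y → RV G x y ∧ S (edgeOf y)) (flags G))
    from (y , r , q) = Any.any⁺ (λ y → RV G x y ∧ S (edgeOf y))
      (lose (∈-flags G {y} (orb-closed V-invs r p))
        (Equivalence.from T-∧ (Equivalence.from (Reach⇔Orb G V-invs {x} {y} p) r , q)))

  isolated-classes : ∀ (S : EdgeSet (m G)) → HasClasses V (λ x → InE G x × ¬ Touch (T ∘ S) x) (isolatedBy G S)
  isolated-classes S = countClasses-orbits G V-invs
    (λ p → mk⇔ (λ h q → subst T (Equivalence.to T-not-≡ h) (Equivalence.from (touch⇔ p) q))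
               (λ n → Equivalence.from T-not-≡ (¬T⇒≡false (n ∘ Equivalence.to (touch⇔ p)))))
    (λ r n q → n (touch-resp (V-sym r) q))
    where
    ¬T⇒≡false : ∀ {b} → ¬ T b → b ≡ false
    ¬T⇒≡false {false} n = refl
    ¬T⇒≡false {true}  n = ⊥-elim (n tt)

  common-classes : ∀ (S S' : EdgeSet (m G)) →
    HasClasses V (λ x → InE G x × Touch (T ∘ S) x × Touch (T ∘ S') x) (commonVertices G S S')
  common-classes S S' = countClasses-orbits G V-invs
    (λ p → mk⇔ (λ h → let a , b = Equivalence.to T-∧ h in Equivalence.to (touch⇔ p) a , Equivalence.to (touch⇔ p) b)
               (λ (a , b) → Equivalence.from T-∧ (Equivalence.from (touch⇔ p) a , Equivalence.from (touch⇔ p) b)))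
    (λ r (a , b) → touch-resp r a , touch-resp r b)

  -- Rotation about a vertex. The flags of a vertex are the rotation cycle of any one of them
  -- together with its mirror image under `θ₂`.
  spin : ℕ → Flag (m G) → Flag (m G)
  spin zero    x = x
  spin (suc n) x = spin n (θ₂ (t x))

  spin-suc : ∀ n x → spin (suc n) x ≡ θ₂ (t (spin n x))
  spin-suc zero x = refl
  spin-suc (suc n) x = spin-suc n (θ₂ (t x))

  spin-InE : ∀ n {x} → InE G x → InE G (spin n x)
  spin-InE zero p = p
  spin-InE (suc n) p = spin-InE n (θ₁-closed _ p)

  θ₂t-injective : ∀ {x y} → InE G x → InE G y → θ₂ (t x) ≡ θ₂ (t y) → x ≡ y
  θ₂t-injective {x} {y} p q eq = trans (sym (θ₁-invol x p)) (trans (cong t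
    (trans (sym (θ₂-involutive (t x))) (trans (cong θ₂ eq) (θ₂-involutive (t y))))) (θ₁-invol y q))

  spin-cancel : ∀ i d {x} → InE G x → spin i x ≡ spin (i + d) x → x ≡ spin d x
  spin-cancel zero d p eq = eq
  spin-cancel (suc i) d {x} p eq = spin-cancel i d p (θ₂t-injective (spin-InE i p) (spin-InE (i + d) p)
    (trans (sym (spin-suc i x)) (trans eq (spin-suc (i + d) x))))

  -- Among 4m + 1 iterates on 4m flags two agree, and injectivity of the rotation strips their
  -- common beginning. The bound 4m is the fuel given to `skip` in the definition of subgraphs.
  spin-period : ∀ {x} → InE G x → ∃ λ p → suc p ≤ 4 * m G × spin (suc p) x ≡ x
  spin-period {x} px
    with pigeonhole {m = length (allFlags (m G))} {n = suc (4 * m G)} (s≤s (≤-reflexive (length-allFlags (m G))))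
      (λ i → index (∈-allFlags (spin (toℕ i) x)))
  ... | i , j , i<j , eq = proj₁ split , bound , period
    where
    eq' : spin (toℕ i) x ≡ spin (toℕ j) x
    eq' = trans (Any.lookup-index (∈-allFlags (spin (toℕ i) x)))
      (trans (cong (lookup (allFlags (m G))) eq) (sym (Any.lookup-index (∈-allFlags (spin (toℕ j) x)))))
    split : ∃ λ d → toℕ i + suc d ≡ toℕ j
    split = let d , q = m≤n⇒∃[o]m+o≡n i<j in d , trans (+-suc (toℕ i) d) q
    bound : suc (proj₁ split) ≤ 4 * m G
    bound = ≤-trans (m≤n+m _ (toℕ i)) (≤-trans (≤-reflexive (proj₂ split)) (toℕ≤pred[n] j))
    period : spin (suc (proj₁ split)) x ≡ x
    period = sym (spin-cancel (toℕ i) (suc (proj₁ split)) px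
      (trans eq' (cong (λ n → spin n x) (sym (proj₂ split)))))

  module Restriction (B : EdgeSet (m G)) (B⊆E : ∀ e → T (B e) → T (E G e)) where

    InB : Flag (m G) → Set
    InB x = T (B (edgeOf x))

    sk : Flag (m G) → Flag (m G)
    sk = skip (4 * m G) B t

    -- Seg x z: z is reached from x by t (θ₂ t)ⁿ with every intermediate flag outside B.
    data Seg : Flag (m G) → Flag (m G) → Set where
      last : ∀ {x} → Seg x (t x)
      step : ∀ {x z} → ¬ InB (t x) → Seg (θ₂ (t x)) z → Seg x z

    skip-seg : ∀ k x → Seg x (skip k B t x)
    skip-seg zero x = last
    skip-seg (suc k) x with B (edgeOf (t x)) in e
    ... | true  = last
    ... | false = step (λ q → subst T e q) (skip-seg k (θ₂ (t x)))

    -- A walk stops at its first flag in `B`, so two walks from `x` that both end in `B` coincide,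
    -- whatever the fuel.
    skip-unique : ∀ {x z} → Seg x z → InB z → ∀ k → InB (skip k B t x) → skip k B t x ≡ z
    skip-unique last q zero r = refl
    skip-unique (step n s) q zero r = contradiction r n
    skip-unique {x} last q (suc k) r with B (edgeOf (t x))
    ... | true = refl
    skip-unique {x} (step n s) q (suc k) r with B (edgeOf (t x))
    ... | true  = ⊥-elim (n tt)
    ... | false = skip-unique s q k r

    seg-append : ∀ {x y z} → Seg x y → ¬ InB y → Seg (θ₂ y) z → Seg x z
    seg-append last n s = step n s
    seg-append (step n' s') n s = step n' (seg-append s' n s)

    -- The reversed walk avoids `B` at the same edges, since `θ₂` stays on its edge. This is what
    -- makes `sk` an involution on `B`.
    seg-sym : ∀ {x z} → InE G x → Seg x z → Seg z x
    seg-sym {x} p last = subst (Seg (t x)) (θ₁-invol x p) last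
    seg-sym {x} p (step n s) = seg-append (seg-sym (θ₁-closed x p) s) n
      (subst (Seg (θ₂ (θ₂ (t x)))) (trans (cong t (θ₂-involutive (t x))) (θ₁-invol x p)) last)

    seg-V : ∀ {x z} → InE G x → Seg x z → V x z
    seg-V p last = V-t p
    seg-V p (step n s) = V-t p ◅◅ V-θ₂ (θ₁-closed _ p) ◅◅ seg-V (θ₁-closed _ p) s

    skip-misses : ∀ k {x} → ¬ InB (skip k B t x) → ∀ j → j ≤ k → ¬ InB (spin (suc j) x)
    skip-misses zero n zero le = n
    skip-misses (suc k) {x} n j le q with B (edgeOf (t x)) in e
    ... | true = n (Equivalence.from T-≡ e)
    skip-misses (suc k) {x} n zero le q | false = subst T e q
    skip-misses (suc k) {x} n (suc j) (s≤s le) q | false = skip-misses k n j le q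

    -- If the walk ran out of fuel, a full turn would avoid `B`. Mirror images under `θ₂` lie on the
    -- same edges, so the whole vertex would avoid `B`.
    skip-lands : ∀ {x} → InE G x → Touch (T ∘ B) x → InB (sk x)
    skip-lands {x} px (z , r , q) with T? (B (edgeOf (sk x)))
    ... | yes l = l
    ... | no n = ⊥-elim (avoids (around r (0 , s≤s z≤n , inj₁ refl)) q)
      where
      p = proj₁ (spin-period px)
      p≤ = proj₁ (proj₂ (spin-period px))
      per : spin (suc p) x ≡ x
      per = proj₂ (proj₂ (spin-period px))
      Near : Flag (m G) → Set
      Near y = ∃ λ j → j < suc p × (y ≡ spin j x ⊎ y ≡ θ₂ (spin j x))
      near-t : ∀ {y} → Near y → Near (t y)
      near-t (j , lt , inj₁ refl) with m≤n⇒m<n∨m≡n lt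
      ... | inj₁ lt' = suc j , lt' , inj₂ (sym (trans (cong θ₂ (spin-suc j x)) (θ₂-involutive _)))
      -- At the last position the turn closes: `t` leads to the mirror image of `x` itself.
      ... | inj₂ refl = 0 , s≤s z≤n , inj₂ (trans (sym (θ₂-involutive _)) (cong θ₂ (trans (sym (spin-suc j x)) per)))
      near-t (zero , lt , inj₂ refl) = p , ≤-refl ,
        inj₁ (trans (cong (t ∘ θ₂) (trans (sym per) (spin-suc p x)))
          (trans (cong t (θ₂-involutive _)) (θ₁-invol _ (spin-InE p px))))
      near-t (suc j , lt , inj₂ refl) = j , ≤-trans (n≤1+n _) lt ,
        inj₁ (trans (cong (t ∘ θ₂) (spin-suc j x))
          (trans (cong t (θ₂-involutive _)) (θ₁-invol _ (spin-InE j px))))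
      near-θ₂ : ∀ {y} → Near y → Near (θ₂ y)
      near-θ₂ (j , lt , inj₁ refl) = j , lt , inj₂ refl
      near-θ₂ (j , lt , inj₂ refl) = j , lt , inj₁ (θ₂-involutive _)
      around : ∀ {y w} → V y w → Near y → Near w
      around ε o = o
      around ((_ , here refl) ◅ s) o = around s (near-t o)
      around ((_ , there (here refl)) ◅ s) o = around s (near-θ₂ o)
      miss : ∀ j → j < suc p → ¬ InB (spin j x)
      -- `skip-misses` speaks of positive iterates only, so `x` is taken as the iterate after a full
      -- turn.
      miss zero lt q = skip-misses (4 * m G) n p (≤-trans (n≤1+n p) p≤) (subst InB (sym per) q)
      miss (suc j) lt q = skip-misses (4 * m G) n j (≤-trans (n≤1+n j) (≤-trans (≤-pred lt) (≤-trans (n≤1+n p) p≤))) q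
      avoids : ∀ {y} → Near y → ¬ InB y
      avoids (j , lt , inj₁ refl) = miss j lt
      avoids (j , lt , inj₂ refl) = miss j lt

    sk-InE : ∀ {x} → InE G x → InE G (sk x)
    sk-InE p = orb-closed V-invs (seg-V p (skip-seg (4 * m G) _)) p

    sk-to : ∀ {x z} → InE G x → Seg x z → InB z → sk x ≡ z
    sk-to p s q = skip-unique s q (4 * m G) (skip-lands p (_ , seg-V p s , q))

    sk-stop : ∀ {x} → InE G x → InB (t x) → sk x ≡ t x
    sk-stop p q = sk-to p last q

    sk-pass : ∀ {x} → InE G x → Touch (T ∘ B) x → ¬ InB (t x) → sk x ≡ sk (θ₂ (t x))
    sk-pass {x} p h n = sk-to p (step n (skip-seg (4 * m G) (θ₂ (t x))))
      (skip-lands (θ₁-closed x p) (touch-resp (V-t p ◅◅ V-θ₂ (θ₁-closed x p)) h))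

    sk-inv : InvolutionOn InB sk
    sk-inv {x} q = skip-lands p (touch-self q) ,
      sk-to (sk-InE p) (seg-sym p (skip-seg (4 * m G) x)) q
      where p = B⊆E _ q

    -- From `sk x` the walk retraces its way to `x`, does not stop there because `x` is outside `B`,
    -- and goes on as the walk from `θ₂ x`.
    sk-sk-outside : ∀ {x} → InE G x → Touch (T ∘ B) x → ¬ InB x → sk (sk x) ≡ sk (θ₂ x)
    sk-sk-outside {x} p h n = sk-to (sk-InE p)
      (seg-append (seg-sym p (skip-seg (4 * m G) x)) n (skip-seg (4 * m G) (θ₂ x)))
      (skip-lands p (touch-resp (V-θ₂ p) h))

    sk-sk-both-outside : ∀ {x} → InE G x → Touch (T ∘ B) x → ¬ InB (t x) → sk (sk (t x)) ≡ sk x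
    sk-sk-both-outside {x} p h n =
      trans (sk-sk-outside (θ₁-closed x p) (touch-resp (V-t p) h) n) (sym (sk-pass p h n))

-- Orbits of a ribbon subgraph compared with orbits of G

module Contraction (G : RibbonGraph) (wf : WF G) (B : EdgeSet (m G)) (B⊆E : ∀ e → T (B e) → T (E G e)) where
  open WF wf
  open Vertices G wf
  open Restriction B B⊆E

  -- For the edges in A this is `G ∣ A`. For the remaining edges it differs from `G ⊖ A` in `nIso`
  -- only, which orientability does not see.
  sub : RibbonGraph
  sub = ribbonGraph (m G) B sk 0

  -- At a vertex that meets `B`, a flag outside `B` is replaced by the flag of `B` reached by
  -- walking round the vertex; orbits of `G` thereby project to orbits of the subgraph.
  proj : Flag (m G) → Flag (m G)
  proj x = if B (edgeOf x) then x else sk x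

  proj-in : ∀ {x} → InB x → proj x ≡ x
  proj-in {x} q with B (edgeOf x)
  ... | true = refl

  proj-out : ∀ {x} → ¬ InB x → proj x ≡ sk x
  proj-out {x} n with B (edgeOf x)
  ... | true  = ⊥-elim (n tt)
  ... | false = refl

  touch? : ∀ {x} → InE G x → Dec (Touch (T ∘ B) x)
  touch? {x} p with T? (any (λ y → RV G x y ∧ B (edgeOf y)) (flags G))
  ... | yes h = yes (Equivalence.to (touch⇔ p) h)
  ... | no n  = no (n ∘ Equivalence.from (touch⇔ p))

  -- The condition on a generator g under which proj sends g-steps on G to R'.
  Projects : (Flag (m G) → Flag (m G) → Set) → (Flag (m G) → Flag (m G)) → Set
  Projects R' g = ∀ {x} → InE G x → g x ≡ t x ⊎
    (edgeOf (g x) ≡ edgeOf x × (InB x → R' x (g x)) × (¬ InB x → g x ≡ x ⊎ g x ≡ θ₂ x))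

  -- The instances are vertices, boundary components and components of the spanning subgraph with
  -- edge set `B`. `gsE` describes them on all flags of `G`, `gsB` on the flags of `B` alone, where
  -- `sk` takes the place of `t`.
  module _ {gsE gsB : List (Flag (m G) → Flag (m G))}
    (R-sym : Symmetric (Orb (InE G) gsE)) (R'-sym : Symmetric (Orb InB gsB))
    (R-t : ∀ {x} → InE G x → Orb (InE G) gsE x (t x))
    (R-θ₂ : ∀ {x} → InE G x → ¬ InB x → Orb (InE G) gsE x (θ₂ x))
    (R'-sk : ∀ {x} → InB x → Orb InB gsB x (sk x))
    (lifts : All (λ g → ∀ {x} → InB x → g x ≡ sk x ⊎ Orb (InE G) gsE x (g x)) gsB)
    (projects : All (Projects (Orb InB gsB)) gsE) where

    private
      R R' : Flag (m G) → Flag (m G) → Set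
      R  = Orb (InE G) gsE
      R' = Orb InB gsB

      seg-R : ∀ {x z} → InE G x → Seg x z → R x z
      seg-R p last = R-t p
      seg-R p (step n s) = R-t p ◅◅ R-θ₂ (θ₁-closed _ p) n ◅◅ seg-R (θ₁-closed _ p) s

      sk-R : ∀ {x} → InE G x → R x (sk x)
      sk-R {x} p = seg-R p (skip-seg (4 * m G) x)

      R'⊆R : ∀ {x y} → R' x y → R x y
      R'⊆R = orb-⊆ ε _◅◅_ (All.map (λ {g} h {x} q → lift {g} q (h q)) lifts)
        where
        lift : ∀ {g x} → InB x → g x ≡ sk x ⊎ R x (g x) → R x (g x)
        lift {x = x} q (inj₁ eq) = subst (R x) (sym eq) (sk-R (B⊆E _ q))
        lift q (inj₂ r) = r

      proj-t : ∀ {x} → InE G x → Touch (T ∘ B) x → R' (proj x) (proj (t x))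
      proj-t {x} p h with T? (B (edgeOf x)) | T? (B (edgeOf (t x)))
      ... | yes q | yes q' rewrite proj-in {x} q | proj-in {t x} q' = subst (R' x) (sk-stop p q') (R'-sk q)
      ... | yes q | no n' rewrite proj-in {x} q | proj-out {t x} n' =
        subst (R' x) (sym (trans (sk-stop (θ₁-closed x p) (subst InB (sym (θ₁-invol x p)) q)) (θ₁-invol x p))) ε
      ... | no n | yes q' rewrite proj-out {x} n | proj-in {t x} q' = subst (R' (sk x)) (sk-stop p q') ε
      ... | no n | no n' rewrite proj-out {x} n | proj-out {t x} n' =
        R'-sym (subst (R' (sk (t x))) (sk-sk-both-outside p h n')
          (R'-sk (skip-lands (θ₁-closed x p) (touch-resp (V-t p) h))))

      proj-θ₂ : ∀ {x} → InE G x → Touch (T ∘ B) x → ¬ InB x → R' (proj x) (proj (θ₂ x))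
      proj-θ₂ {x} p h n rewrite proj-out {x} n | proj-out {θ₂ x} n =
        subst (R' (sk x)) (sk-sk-outside p h n) (R'-sk (skip-lands p h))

      proj-step : ∀ {g} → Projects R' g → ∀ {x} → InE G x → Touch (T ∘ B) x →
        InE G (g x) × Touch (T ∘ B) (g x) × R' (proj x) (proj (g x))
      proj-step pg {x} p h with pg {x} p
      ... | inj₁ eq rewrite eq = θ₁-closed x p , touch-resp (V-t p) h , proj-t p h
      ... | inj₂ (eq , ins , out) with T? (B (edgeOf x))
      ...   | yes q = B⊆E _ q' , touch-self q' , subst₂ R' (sym (proj-in q)) (sym (proj-in q')) (ins q)
        where q' = subst (T ∘ B) (sym eq) q
      ...   | no n with out n
      ...     | inj₁ eq' rewrite eq' = p , h , ε
      ...     | inj₂ eq' rewrite eq' = p , touch-resp (V-θ₂ p) h , proj-θ₂ p h n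

      proj-R : ∀ {x y} → R x y → InE G x → Touch (T ∘ B) x → R' (proj x) (proj y)
      proj-R ε p h = ε
      proj-R ((_ , a) ◅ s) p h with pick projects a
      ... | g , pg , refl = let p' , h' , r = proj-step {g} pg p h in r ◅◅ proj-R s p' h'

      isolated-step : ∀ {g} → Projects R' g → ∀ {x} → InE G x → ¬ InB x → V x (g x)
      isolated-step pg {x} p n with pg {x} p
      ... | inj₁ eq = subst (V x) (sym eq) (V-t p)
      ... | inj₂ (_ , _ , out) with out n
      ...   | inj₁ eq = subst (V x) (sym eq) ε
      ...   | inj₂ eq = subst (V x) (sym eq) (V-θ₂ p)

      isolated-R : ∀ {x y} → R x y → ¬ Touch (T ∘ B) x → V x y
      isolated-R ε n = ε
      isolated-R ((p , a) ◅ s) n with pick projects a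
      ... | g , pg , refl = let v = isolated-step {g} pg p (n ∘ touch-self) in
        v ◅◅ isolated-R s (n ∘ touch-resp (V-sym v))

      isolated-V : ∀ {x y} → V x y → ¬ Touch (T ∘ B) x → R x y
      isolated-V ε n = ε
      isolated-V ((p , here refl) ◅ s) n = R-t p ◅◅ isolated-V s (n ∘ touch-resp (V-sym (V-t p)))
      isolated-V ((p , there (here refl)) ◅ s) n =
        R-θ₂ p (n ∘ touch-self) ◅◅ isolated-V s (n ∘ touch-resp (V-sym (V-θ₂ p)))

      meets : ∀ {x} → InE G x → (∃ λ z → InB z × R x z) ⊎ (∃ λ z → (InE G z × ¬ Touch (T ∘ B) z) × R x z)
      meets {x} p with touch? p
      ... | yes h = inj₁ (sk x , skip-lands p h , sk-R p)
      ... | no n  = inj₂ (x , (p , n) , ε)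

    restriction-R : ∀ {x y} → InB x → InB y → R x y → R' x y
    restriction-R q q' r = subst₂ R' (proj-in q) (proj-in q') (proj-R r (B⊆E _ q) (touch-self q))

    -- A flag whose vertex meets `B` is `R`-related to a flag of `B`, and there `R` restricts to
    -- `R'`. Any other `R`-class is a single entire vertex that misses `B`, which accounts for the
    -- second summand.
    classes-restriction : ∀ {n} → HasClasses R' InB n → HasClasses R (InE G) (n + isolatedBy G B)
    classes-restriction h = classes-⊎ _◅◅_ (B⊆E _) proj₁
      restriction-R
      (λ (_ , n) _ r → isolated-R r n)
      (λ {x} q (_ , n) r → n (touch-resp (V-sym (isolated-R (R-sym r) n)) (touch-self q)))
      (λ _ → R'⊆R) (λ (_ , n) v → isolated-V v n) meets h (isolated-classes B)

  onB : (Flag (m G) → Flag (m G)) → (Flag (m G) → Flag (m G)) → Flag (m G) → Flag (m G)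
  onB g h x = if B (edgeOf x) then g x else h x

  onB-in : ∀ g h x → InB x → onB g h x ≡ g x
  onB-in g h x q with B (edgeOf x)
  ... | true = refl

  onB-out : ∀ g h x → ¬ InB x → onB g h x ≡ h x
  onB-out g h x n with B (edgeOf x)
  ... | true  = ⊥-elim (n tt)
  ... | false = refl

  θ₀-invE : InvolutionOn (InE G) θ₀
  θ₀-invE p = p , θ₀-involutive _

  θ₀-invB : InvolutionOn InB θ₀
  θ₀-invB p = p , θ₀-involutive _

  θ₂-invB : InvolutionOn InB θ₂
  θ₂-invB p = p , θ₂-involutive _

  -- `σ` crosses the edges in `B` and ignores the others: with `t` and `θ₂` its orbits are the
  -- components of the spanning subgraph. `τ` follows the side of an edge in `B` and passes over the
  -- end of a missing edge: with `t` its orbits are the boundary components.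
  σ τ : Flag (m G) → Flag (m G)
  σ = onB θ₀ id
  τ = onB θ₀ θ₂

  σ-inv : InvolutionOn (InE G) σ
  σ-inv {x} p with B (edgeOf x) in e
  ... | true  rewrite e = p , θ₀-involutive x
  ... | false rewrite e = p , refl

  τ-inv : InvolutionOn (InE G) τ
  τ-inv {x} p with B (edgeOf x) in e
  ... | true  rewrite e = p , θ₀-involutive x
  ... | false rewrite e = p , θ₂-involutive x

  τ-edge : ∀ x → edgeOf (τ x) ≡ edgeOf x
  τ-edge x with B (edgeOf x)
  ... | true  = refl
  ... | false = refl

  σ-edge : ∀ x → edgeOf (σ x) ≡ edgeOf x
  σ-edge x with B (edgeOf x)
  ... | true  = refl
  ... | false = refl

  F-invs : All (InvolutionOn (InE G)) (τ ∷ t ∷ [])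
  F-invs = (λ {x} → τ-inv {x}) ∷ (λ {x} → t-inv {x}) ∷ []

  K-invs : All (InvolutionOn (InE G)) (t ∷ θ₂ ∷ σ ∷ [])
  K-invs = (λ {x} → t-inv {x}) ∷ (λ {x} → θ₂-inv {x}) ∷ (λ {x} → σ-inv {x}) ∷ []

  F K : Flag (m G) → Flag (m G) → Set
  F = Orb (InE G) (τ ∷ t ∷ [])
  K = Orb (InE G) (t ∷ θ₂ ∷ σ ∷ [])

  K-sym : Symmetric K
  K-sym = orb-sym K-invs

  V⊆K : ∀ {x y} → V x y → K x y
  V⊆K = orb-⊆ ε _◅◅_ ((λ p → orb-step (here refl) p) ∷ (λ p → orb-step (there (here refl)) p) ∷ [])

  K-θ₀ : ∀ {x} → InB x → K x (θ₀ x)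
  K-θ₀ {x} q = subst (K x) (onB-in θ₀ id x q) (orb-step (there (there (here refl))) (B⊆E _ q))

  sub-V-classes : HasClasses V (InE G) (countOrbits sub (sk ∷ θ₂ ∷ []) + isolatedBy G B)
  sub-V-classes = classes-restriction V-sym (orb-sym invs) V-t (λ p _ → V-θ₂ p) (orb-step (here refl))
    ((λ q → inj₁ refl) ∷ (λ q → inj₂ (V-θ₂ (B⊆E _ q))) ∷ [])
    ((λ p → inj₁ refl) ∷ (λ p → inj₂ (refl , orb-step (there (here refl)) , λ _ → inj₂ refl)) ∷ [])
    (countOrbits-classes sub invs)
    where
    invs : All (InvolutionOn InB) (sk ∷ θ₂ ∷ [])
    invs = (λ {x} → sk-inv {x}) ∷ (λ {x} → θ₂-invB {x}) ∷ []

  sub-F-classes : HasClasses F (InE G) (countOrbits sub (θ₀ ∷ sk ∷ []) + isolatedBy G B)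
  sub-F-classes = classes-restriction (orb-sym F-invs) (orb-sym invs) (orb-step (there (here refl)))
    (λ {x} p n → subst (F x) (onB-out θ₀ θ₂ x n) (orb-step (here refl) p)) (orb-step (there (here refl)))
    ((λ {x} q → inj₂ (subst (F x) (onB-in θ₀ θ₂ x q) (orb-step (here refl) (B⊆E _ q)))) ∷ (λ q → inj₁ refl) ∷ [])
    ((λ {x} p → inj₂ (τ-edge x , (λ q → subst (Orb InB (θ₀ ∷ sk ∷ []) x) (sym (onB-in θ₀ θ₂ x q)) (orb-step (here refl) q)) ,
                                λ n → inj₂ (onB-out θ₀ θ₂ x n)))
     ∷ (λ p → inj₁ refl) ∷ [])
    (countOrbits-classes sub invs)
    where
    invs : All (InvolutionOn InB) (θ₀ ∷ sk ∷ [])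
    invs = (λ {x} → θ₀-invB {x}) ∷ (λ {x} → sk-inv {x}) ∷ []

  KB : Flag (m G) → Flag (m G) → Set
  KB = Orb InB (θ₀ ∷ sk ∷ θ₂ ∷ [])

  KB-invs : All (InvolutionOn InB) (θ₀ ∷ sk ∷ θ₂ ∷ [])
  KB-invs = (λ {x} → θ₀-invB {x}) ∷ (λ {x} → sk-inv {x}) ∷ (λ {x} → θ₂-invB {x}) ∷ []

  sub-components : HasClasses KB InB (countOrbits sub (θ₀ ∷ sk ∷ θ₂ ∷ []))
  sub-components = countOrbits-classes sub KB-invs

  private
    K-lifts : All (λ g → ∀ {x} → InB x → g x ≡ sk x ⊎ K x (g x)) (θ₀ ∷ sk ∷ θ₂ ∷ [])
    K-lifts = (λ q → inj₂ (K-θ₀ q)) ∷ (λ q → inj₁ refl) ∷ (λ q → inj₂ (V⊆K (V-θ₂ (B⊆E _ q)))) ∷ []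

    K-projects : All (Projects KB) (t ∷ θ₂ ∷ σ ∷ [])
    K-projects = (λ p → inj₁ refl)
      ∷ (λ p → inj₂ (refl , orb-step (there (there (here refl))) , λ _ → inj₂ refl))
      ∷ (λ {x} p → inj₂ (σ-edge x , (λ q → subst (KB x) (sym (onB-in θ₀ id x q)) (orb-step (here refl) q)) ,
                                    λ n → inj₁ (onB-out θ₀ id x n))) ∷ []

  K⇒KB : ∀ {x y} → InB x → InB y → K x y → KB x y
  K⇒KB = restriction-R K-sym (orb-sym KB-invs) (V⊆K ∘ V-t) (λ p _ → V⊆K (V-θ₂ p)) (orb-step (there (here refl)))
    K-lifts K-projects

  sub-K-classes : HasClasses K (InE G) (countOrbits sub (θ₀ ∷ sk ∷ θ₂ ∷ []) + isolatedBy G B)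
  sub-K-classes = classes-restriction K-sym (orb-sym KB-invs) (V⊆K ∘ V-t) (λ p _ → V⊆K (V-θ₂ p))
    (orb-step (there (here refl))) K-lifts K-projects sub-components

  KB⇒K : ∀ {x y} → KB x y → K x y
  KB⇒K = orb-⊆ ε _◅◅_ ((λ q → K-θ₀ q) ∷ (λ q → V⊆K (seg-V (B⊆E _ q) (skip-seg (4 * m G) _)))
    ∷ (λ q → V⊆K (V-θ₂ (B⊆E _ q))) ∷ [])

  -- Colourings

  -- A walk consists of `t`-steps separated by `θ₂`-steps, an odd number of colour changes in all,
  -- so `sk` reverses the colour.
  sub-orientable : Orientable G → Orientable sub
  sub-orientable (c , alt) = c , λ x q →
    let p = B⊆E _ q in proj₁ (alt x p) ,
      (λ eq → not-¬ (sym eq) (seg-alt p (skip-seg (4 * m G) x))) , proj₂ (proj₂ (alt x p))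
    where
    seg-alt : ∀ {x z} → InE G x → Seg x z → c x ≡ not (c z)
    seg-alt {x} p last = trans (sym (not-involutive (c x))) (cong not (sym (¬-not (proj₁ (proj₂ (alt x p))))))
    seg-alt {x} p (step n s) = trans
      (trans (sym (not-involutive (c x))) (cong not (sym (¬-not (proj₁ (proj₂ (alt x p)))))))
      (trans (sym (¬-not (proj₂ (proj₂ (alt (t x) (θ₁-closed x p)))))) (seg-alt (θ₁-closed x p) s))

  -- By the same parity, a flag outside `B` takes the colour opposite to that of the flag found by
  -- `sk`. At a vertex that misses `B` there is no such flag, and nothing is claimed.
  extend-colouring : Orientable sub → ∃ λ (d : Flag (m G) → Bool) →
    (∀ {x} → InE G x → Touch (T ∘ B) x → d (t x) ≡ not (d x) × d (θ₂ x) ≡ not (d x)) ×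
    (∀ {x} → InB x → d (θ₀ x) ≡ not (d x))
  extend-colouring (c , alt) = d , (λ p h → d-t p h , d-θ₂ p h) , d-θ₀
    where
    c-θ₀ : ∀ {x} → InB x → c (θ₀ x) ≡ not (c x)
    c-θ₀ q = ¬-not (proj₁ (alt _ q))
    c-sk : ∀ {x} → InB x → c (sk x) ≡ not (c x)
    c-sk q = ¬-not (proj₁ (proj₂ (alt _ q)))
    c-θ₂ : ∀ {x} → InB x → c (θ₂ x) ≡ not (c x)
    c-θ₂ q = ¬-not (proj₂ (proj₂ (alt _ q)))
    d : Flag (m G) → Bool
    d x = if B (edgeOf x) then c x else not (c (sk x))
    d-in : ∀ {x} → InB x → d x ≡ c x
    d-in {x} q with B (edgeOf x)
    ... | true = refl
    d-out : ∀ {x} → ¬ InB x → d x ≡ not (c (sk x))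
    d-out {x} n with B (edgeOf x)
    ... | true  = ⊥-elim (n tt)
    ... | false = refl
    d-θ₀ : ∀ {x} → InB x → d (θ₀ x) ≡ not (d x)
    d-θ₀ {x} q rewrite d-in {x} q | d-in {θ₀ x} q = c-θ₀ q
    d-θ₂ : ∀ {x} → InE G x → Touch (T ∘ B) x → d (θ₂ x) ≡ not (d x)
    d-θ₂ {x} p h with T? (B (edgeOf x))
    ... | yes q rewrite d-in {x} q | d-in {θ₂ x} q = c-θ₂ q
    ... | no n rewrite d-out {x} n | d-out {θ₂ x} n =
      cong not (trans (cong c (sym (sk-sk-outside p h n))) (c-sk (skip-lands p h)))
    d-t : ∀ {x} → InE G x → Touch (T ∘ B) x → d (t x) ≡ not (d x)
    d-t {x} p h with T? (B (edgeOf x)) | T? (B (edgeOf (t x)))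
    ... | yes q | yes q' rewrite d-in {x} q | d-in {t x} q' = trans (cong c (sym (sk-stop p q'))) (c-sk q)
    ... | yes q | no n' rewrite d-in {x} q | d-out {t x} n' = cong (not ∘ c)
      (trans (sk-stop (θ₁-closed x p) (subst InB (sym (θ₁-invol x p)) q)) (θ₁-invol x p))
    ... | no n | yes q' rewrite d-out {x} n | d-in {t x} q' =
      trans (cong c (sym (sk-stop p q'))) (sym (not-involutive _))
    ... | no n | no n' rewrite d-out {x} n | d-out {t x} n' = trans
      (sym (c-sk (skip-lands (θ₁-closed x p) (touch-resp (V-t p) h))))
      (trans (cong c (sk-sk-both-outside p h n')) (sym (not-involutive _)))

-- Partial duals

module _ {m} (A : EdgeSet m) where

  tr-involutive : ∀ x → tr A (tr A x) ≡ x
  tr-involutive (e , a , b) with A e in eq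
  ... | true  rewrite eq = refl
  ... | false rewrite eq = refl

  tr-edge : ∀ x → edgeOf (tr A x) ≡ edgeOf x
  tr-edge (e , a , b) with A e
  ... | true  = refl
  ... | false = refl

  tr-θ₀ : ∀ x → tr A (θ₀ x) ≡ θ₀ (tr A x) ⊎ tr A (θ₀ x) ≡ θ₂ (tr A x)
  tr-θ₀ (e , a , b) with A e
  ... | true  = inj₂ refl
  ... | false = inj₁ refl

  tr-θ₂ : ∀ x → tr A (θ₂ x) ≡ θ₂ (tr A x) ⊎ tr A (θ₂ x) ≡ θ₀ (tr A x)
  tr-θ₂ (e , a , b) with A e
  ... | true  = inj₂ refl
  ... | false = inj₁ refl

module Dual (G : RibbonGraph) (wf : WF G) (A : EdgeSet (m G)) where
  open WF wf
  open Vertices G wf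

  -- The Boolean index treats both sides in one statement, and `mask (tag i)` unfolds to the edge
  -- set in `summands-are-components`.
  mask : Bool → EdgeSet (m G)
  mask b = if b then (E G ∩ₑ A) else (A ᶜ[ E G ])

  mask⊆E : ∀ b e → T (mask b e) → T (E G e)
  mask⊆E true  e h = proj₁ (Equivalence.to T-∧ h)
  mask⊆E false e h = proj₁ (Equivalence.to T-∧ h)

  module Side (b : Bool) = Contraction G wf (mask b) (mask⊆E b)
  module On  = Side true
  module Off = Side false

  t' : Flag (m G) → Flag (m G)
  t' = θ₁ (G ^ A)

  tr-InE : ∀ {x} → InE G x → InE G (tr A x)
  tr-InE {x} p = subst (T ∘ E G) (sym (tr-edge A x)) p

  t'-inv : InvolutionOn (InE G) t'
  t'-inv {x} p = tr-InE (θ₁-closed _ (tr-InE p)) ,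
    trans (cong (tr A ∘ t) (tr-involutive A _))
      (trans (cong (tr A) (θ₁-invol _ (tr-InE {x} p))) (tr-involutive A x))

  tr-t : ∀ x → t' (tr A x) ≡ tr A (t x)
  tr-t x = cong (tr A ∘ t) (tr-involutive A x)

  tr-t' : ∀ x → t (tr A x) ≡ tr A (t' x)
  tr-t' x = sym (tr-involutive A (t (tr A x)))

  -- Since `tr A` exchanges `θ₀` and `θ₂` on A, the dual's `θ₂` becomes `τ` for A, and vertices of
  -- the dual become boundary components of (V, A). In the same way its `θ₀` becomes `τ` for the
  -- complement and yields the faces.
  tr-τ-on : ∀ {x} → InE G x → θ₂ (tr A x) ≡ tr A (On.τ x)
  tr-τ-on {e , a , b} p with E G e | A e in eq
  ... | true | true  rewrite eq = refl
  ... | true | false rewrite eq = refl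

  tr-τ-off : ∀ {x} → InE G x → θ₀ (tr A x) ≡ tr A (Off.τ x)
  tr-τ-off {e , a , b} p with E G e | A e in eq
  ... | true | true  rewrite eq = refl
  ... | true | false rewrite eq = refl

  swap-tr : ∀ {g h : Flag (m G) → Flag (m G)} → (∀ {x} → InE G x → g (tr A x) ≡ tr A (h x)) →
    ∀ {x} → InE G x → h (tr A x) ≡ tr A (g x)
  swap-tr {g} {h} eq {x} p = trans (sym (tr-involutive A _))
    (cong (tr A) (trans (sym (eq (tr-InE p))) (cong g (tr-involutive A x))))

  module _ {gs gs' : List (Flag (m G) → Flag (m G))}
    (fwd : All (λ g → ∀ {x} → InE G x → Orb (InE G) gs (tr A x) (tr A (g x))) gs')
    (bwd : All (λ g → ∀ {x} → InE G x → Orb (InE G) gs' (tr A x) (tr A (g x))) gs) where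

    dual-classes : ∀ {n} → HasClasses (Orb (InE G) gs') (InE G) n → HasClasses (Orb (InE G) gs) (InE G) n
    dual-classes = classes-map (tr A) _◅◅_ tr-InE
      (orb-gmap {R = Orb (InE G) gs} (tr A) ε _◅◅_ fwd)
      (λ {x} {y} _ _ r → subst₂ (Orb (InE G) gs') (tr-involutive A x) (tr-involutive A y)
        (orb-gmap {R = Orb (InE G) gs'} (tr A) ε _◅◅_ bwd r))
      (λ {y} q → tr A y , tr-InE q , subst (Orb (InE G) gs y) (sym (tr-involutive A y)) ε)

  along : ∀ {gs g} {x y : Flag (m G)} → g ∈ gs → InE G x → g x ≡ y → Orb (InE G) gs x y
  along {gs} {x = x} g∈ p eq = subst (Orb (InE G) gs x) eq (orb-step g∈ p)

  dual-V-classes : HasClasses On.F (InE G) (countOrbits (G ^ A) (t' ∷ θ₂ ∷ []))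
  dual-V-classes = dual-classes
    ((λ {x} p → along (there (here refl)) (tr-InE p) (tr-t' x)) ∷
     (λ {x} p → along (here refl) (tr-InE p) (swap-tr {θ₂} {On.τ} tr-τ-on {x} p)) ∷ [])
    ((λ {x} p → along (there (here refl)) (tr-InE p) (tr-τ-on {x} p)) ∷
     (λ {x} p → along (here refl) (tr-InE p) (tr-t x)) ∷ [])
    (countOrbits-classes (G ^ A) ((λ {x} → t'-inv {x}) ∷ (λ {x} → θ₂-inv {x}) ∷ []))

  dual-F-classes : HasClasses Off.F (InE G) (countOrbits (G ^ A) (θ₀ ∷ t' ∷ []))
  dual-F-classes = dual-classes
    ((λ {x} p → along (here refl) (tr-InE p) (swap-tr {θ₀} {Off.τ} tr-τ-off {x} p)) ∷
     (λ {x} p → along (there (here refl)) (tr-InE p) (tr-t' x)) ∷ [])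
    ((λ {x} p → along (here refl) (tr-InE p) (tr-τ-off {x} p)) ∷
     (λ {x} p → along (there (here refl)) (tr-InE p) (tr-t x)) ∷ [])
    (countOrbits-classes (G ^ A) ((λ {x} → On.θ₀-invE {x}) ∷ (λ {x} → t'-inv {x}) ∷ []))

  Conn : Flag (m G) → Flag (m G) → Set
  Conn = Orb (InE G) (θ₀ ∷ t ∷ θ₂ ∷ [])

  Conn-invs : All (InvolutionOn (InE G)) (θ₀ ∷ t ∷ θ₂ ∷ [])
  Conn-invs = (λ {x} → On.θ₀-invE {x}) ∷ (λ {x} → t-inv {x}) ∷ (λ {x} → θ₂-inv {x}) ∷ []

  Conn-classes : HasClasses Conn (InE G) (countOrbits G (θ₀ ∷ t ∷ θ₂ ∷ []))
  Conn-classes = countOrbits-classes G Conn-invs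

  dual-K-classes : HasClasses Conn (InE G) (countOrbits (G ^ A) (θ₀ ∷ t' ∷ θ₂ ∷ []))
  dual-K-classes = dual-classes
    ((λ {x} p → ends (here refl) (there (there (here refl))) p (tr-θ₀ A x)) ∷
     (λ {x} p → along (there (here refl)) (tr-InE p) (tr-t' x)) ∷
     (λ {x} p → ends (there (there (here refl))) (here refl) p (tr-θ₂ A x)) ∷ [])
    ((λ {x} p → ends (here refl) (there (there (here refl))) p (tr-θ₀ A x)) ∷
     (λ {x} p → along (there (here refl)) (tr-InE p) (tr-t x)) ∷
     (λ {x} p → ends (there (there (here refl))) (here refl) p (tr-θ₂ A x)) ∷ [])
    (countOrbits-classes (G ^ A) ((λ {x} → On.θ₀-invE {x}) ∷ (λ {x} → t'-inv {x}) ∷ (λ {x} → θ₂-inv {x}) ∷ []))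
    where
    ends : ∀ {gs g h x y} → g ∈ gs → h ∈ gs → InE G x → y ≡ g (tr A x) ⊎ y ≡ h (tr A x) → Orb (InE G) gs (tr A x) y
    ends g∈ h∈ p (inj₁ eq) = along g∈ (tr-InE p) (sym eq)
    ends g∈ h∈ p (inj₂ eq) = along h∈ (tr-InE p) (sym eq)

  module _ {s s' : Flag (m G) → Flag (m G)} (s≗ : ∀ x → s' (tr A x) ≡ tr A (s x))
    (c : Flag (m G) → Bool)
    (alt : ∀ x → InE G x → (c (θ₀ x) ≢ c x) × (c (s' x) ≢ c x) × (c (θ₂ x) ≢ c x)) where

    retract-colouring : ∀ x → InE G x → (c (tr A (θ₀ x)) ≢ c (tr A x)) ×
      (c (tr A (s x)) ≢ c (tr A x)) × (c (tr A (θ₂ x)) ≢ c (tr A x))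
    retract-colouring x p with alt (tr A x) (tr-InE p)
    ... | a₀ , a₁ , a₂ = either a₀ a₂ (tr-θ₀ A x) , a₁ ∘ trans (cong c (s≗ x)) , either a₂ a₀ (tr-θ₂ A x)
      where
      either : ∀ {y z w} → c y ≢ c (tr A x) → c z ≢ c (tr A x) → w ≡ y ⊎ w ≡ z → c w ≢ c (tr A x)
      either n _ (inj₁ refl) = n
      either _ n (inj₂ refl) = n

  dual-orientable : Orientable (G ^ A) ⇔ Orientable G
  dual-orientable = mk⇔
    (λ (c , alt) → c ∘ tr A , retract-colouring {t} {t'} tr-t c alt)
    (λ (c , alt) → c ∘ tr A , retract-colouring {t'} {t} tr-t' c alt)

  #E-split : #E (G ∣ A) + #E (G ⊖ A) ≡ #E G
  #E-split = go (allFin (m G))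
    where
    go : ∀ es → length (filterᵇ (E G ∩ₑ A) es) + length (filterᵇ (A ᶜ[ E G ]) es) ≡ length (filterᵇ (E G) es)
    go [] = refl
    go (e ∷ es) with E G e | A e
    ... | true  | true  = cong suc (go es)
    ... | true  | false = trans (+-suc _ _) (cong suc (go es))
    ... | false | _     = go es

-- Euler's formula: the genus equation as an equation between numbers of components and vertices

genus-balance : ∀ {n k v₁ f₁ k₁ e₁ w₁ v₂ f₂ k₂ e₂ w₂} → v₁ + w₁ ≡ v₂ + w₂ →
  ((pos (2 * (k + n)) -ℤ pos (f₁ + w₁ + n)) +ℤ pos (e₁ + e₂)) -ℤ pos (f₂ + w₂ + n)
    ≡ (((pos (2 * (k₁ + 0)) -ℤ pos (v₁ + 0)) +ℤ pos e₁) -ℤ pos (f₁ + 0))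
      +ℤ (((pos (2 * (k₂ + (n + w₂))) -ℤ pos (v₂ + (n + w₂))) +ℤ pos e₂) -ℤ pos (f₂ + (n + w₂)))
  ⇔ (k₁ + w₁) + (k₂ + w₂) ≡ (v₁ + w₁) + k
genus-balance {n} {k} {v₁} {f₁} {k₁} {e₁} {w₁} {v₂} {f₂} {k₂} {e₂} {w₂} hv = mk⇔ to from
  where
  D = ((pos (2 * (k + n)) -ℤ pos (f₁ + w₁ + n)) +ℤ pos (e₁ + e₂)) -ℤ pos (f₂ + w₂ + n)
  S = (((pos (2 * (k₁ + 0)) -ℤ pos (v₁ + 0)) +ℤ pos e₁) -ℤ pos (f₁ + 0))
      +ℤ (((pos (2 * (k₂ + (n + w₂))) -ℤ pos (v₂ + (n + w₂))) +ℤ pos e₂) -ℤ pos (f₂ + (n + w₂)))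
  z = pos ((k₁ + w₁) + (k₂ + w₂)) -ℤ pos ((v₁ + w₁) + k)
  w = pos (v₁ + w₁) -ℤ pos (v₂ + w₂)
  -- The two genus expressions differ by 2z + w, and w = 0 because both sides count the same
  -- vertices. The identity has the shape into which `2 * x` unfolds, so that its instance at
  -- natural numbers reduces to the goal.
  identity : ∀ n k v₁ f₁ k₁ e₁ w₁ v₂ f₂ k₂ e₂ w₂ → let 0z = pos 0 in
    (((k₁ +ℤ 0z +ℤ (k₁ +ℤ 0z +ℤ 0z)) -ℤ (v₁ +ℤ 0z) +ℤ e₁) -ℤ (f₁ +ℤ 0z))
      +ℤ ((((k₂ +ℤ (n +ℤ w₂)) +ℤ ((k₂ +ℤ (n +ℤ w₂)) +ℤ 0z)) -ℤ (v₂ +ℤ (n +ℤ w₂)) +ℤ e₂) -ℤ (f₂ +ℤ (n +ℤ w₂)))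
    ≡ ((((k +ℤ n) +ℤ ((k +ℤ n) +ℤ 0z)) -ℤ (f₁ +ℤ w₁ +ℤ n) +ℤ (e₁ +ℤ e₂)) -ℤ (f₂ +ℤ w₂ +ℤ n))
      +ℤ ((((k₁ +ℤ w₁) +ℤ (k₂ +ℤ w₂) -ℤ ((v₁ +ℤ w₁) +ℤ k)) +ℤ ((k₁ +ℤ w₁) +ℤ (k₂ +ℤ w₂) -ℤ ((v₁ +ℤ w₁) +ℤ k)))
         +ℤ ((v₁ +ℤ w₁) -ℤ (v₂ +ℤ w₂)))
  identity = solve 12 (λ n k v₁ f₁ k₁ e₁ w₁ v₂ f₂ k₂ e₂ w₂ → let 0z = con (pos 0) in
    (((k₁ :+ 0z :+ (k₁ :+ 0z :+ 0z)) :- (v₁ :+ 0z) :+ e₁) :- (f₁ :+ 0z))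
      :+ ((((k₂ :+ (n :+ w₂)) :+ ((k₂ :+ (n :+ w₂)) :+ 0z)) :- (v₂ :+ (n :+ w₂)) :+ e₂) :- (f₂ :+ (n :+ w₂)))
    := ((((k :+ n) :+ ((k :+ n) :+ 0z)) :- (f₁ :+ w₁ :+ n) :+ (e₁ :+ e₂)) :- (f₂ :+ w₂ :+ n))
      :+ ((((k₁ :+ w₁) :+ (k₂ :+ w₂) :- ((v₁ :+ w₁) :+ k)) :+ ((k₁ :+ w₁) :+ (k₂ :+ w₂) :- ((v₁ :+ w₁) :+ k)))
         :+ ((v₁ :+ w₁) :- (v₂ :+ w₂)))) refl
    where open +-*-Solver
  w≡0 : w ≡ pos 0
  w≡0 = ℤ.i≡j⇒i-j≡0 (cong pos hv)
  S≡ : S ≡ D +ℤ (z +ℤ z)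
  S≡ = trans (identity (pos n) (pos k) (pos v₁) (pos f₁) (pos k₁) (pos e₁) (pos w₁) (pos v₂) (pos f₂) (pos k₂) (pos e₂) (pos w₂))
    (cong (D +ℤ_) (trans (cong ((z +ℤ z) +ℤ_) w≡0) (ℤ.+-identityʳ _)))
  halve : ∀ i → i +ℤ i ≡ pos 0 → i ≡ pos 0
  halve (pos zero) eq = refl
  to : D ≡ S → (k₁ + w₁) + (k₂ + w₂) ≡ (v₁ + w₁) + k
  to eq = ℤ.+-injective (ℤ.i-j≡0⇒i≡j _ _ (halve z (identityʳ-unique D _ (trans (sym S≡) (sym eq)))))
  from : (k₁ + w₁) + (k₂ + w₂) ≡ (v₁ + w₁) + k → D ≡ S
  from eq = sym (trans S≡ (trans (cong (λ i → D +ℤ (i +ℤ i)) (ℤ.i≡j⇒i-j≡0 (cong pos eq))) (ℤ.+-identityʳ D)))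

-- Components of the two sides and the vertices between them

module Components (G : RibbonGraph) (wf : WF G) (A : EdgeSet (m G)) where
  open WF wf
  open Vertices G wf
  open Dual G wf A

  InM : Bool → Flag (m G) → Set
  InM b x = T (mask b (edgeOf x))

  K : Bool → Flag (m G) → Flag (m G) → Set
  K b = Side.K b

  mask-unique : ∀ b b' e → T (mask b e) → T (mask b' e) → b ≡ b'
  mask-unique true true e h h' = refl
  mask-unique false false e h h' = refl
  mask-unique true false e h h' with E G e | A e
  ... | true | true = ⊥-elim h'
  mask-unique false true e h h' with E G e | A e
  ... | true | true = ⊥-elim h

  mask-cover : ∀ e → T (E G e) → T (mask (A e) e)
  mask-cover e h with E G e in eq | A e in eq'
  ... | true | true  rewrite eq | eq' = tt
  ... | true | false rewrite eq | eq' = tt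

  base : Fin (m G) → Flag (m G)
  base e = e , false , false

  -- `ConnIn` compares edges through their base flags; this carries it to arbitrary flags.
  K-base : ∀ b x → InM b x → K b x (base (edgeOf x))
  K-base b (e , false , false) q = ε
  K-base b (e , false , true) q = Side.V⊆K b (V-θ₂ (mask⊆E b e q))
  K-base b (e , true , false) q = Side.K-θ₀ b q
  K-base b (e , true , true) q = Side.V⊆K b (V-θ₂ (mask⊆E b e q)) ◅◅ Side.K-θ₀ b q

  -- A single relation whose classes are the components of both sides, that is, the nodes of the
  -- bipartite graph. It is transitive because an edge lies on one side only.
  Joined : Flag (m G) → Flag (m G) → Set
  Joined x y = ∃ λ b → InM b x × InM b y × K b x y

  joined-refl : ∀ {x} → InE G x → Joined x x
  joined-refl {x} p = A (edgeOf x) , mask-cover _ p , mask-cover _ p , ε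

  joined-sym : Symmetric Joined
  joined-sym (b , q , q' , r) = b , q' , q , Side.K-sym b r

  joined-trans : Transitive Joined
  joined-trans {x} {y} (b , q , q' , r) (b' , s , s' , r') with mask-unique b b' (edgeOf y) q' s
  ... | refl = b , q , s' , r ◅◅ r'

  joined-InE : ∀ {x y} → Joined x y → InE G x × InE G y
  joined-InE (b , q , q' , _) = mask⊆E b _ q , mask⊆E b _ q'

  component-classes : HasClasses Joined (InE G) (countOrbits On.sub (θ₀ ∷ θ₁ On.sub ∷ θ₂ ∷ [])
    + countOrbits Off.sub (θ₀ ∷ θ₁ Off.sub ∷ θ₂ ∷ []))
  component-classes = classes-⊎ joined-trans (λ {x} → mask⊆E true (edgeOf x)) (λ {x} → mask⊆E false (edgeOf x))
    (λ {x} {y} → restrict true {x} {y}) (λ {x} {y} → restrict false {x} {y})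
    (λ { {x} {y} q q' (b , s , s' , _) → contradiction (trans (mask-unique true b (edgeOf x) q s) (mask-unique b false (edgeOf y) s' q')) λ () })
    (λ {x} {y} → include true {x} {y}) (λ {x} {y} → include false {x} {y}) split On.sub-components Off.sub-components
    where
    restrict : ∀ b {x y} → InM b x → InM b y → Joined x y → Side.KB b x y
    restrict b {x} q q' (b' , s , _ , r) with mask-unique b b' (edgeOf x) q s
    ... | refl = Side.K⇒KB b q q' r
    include : ∀ b {x y} → InM b x → Side.KB b x y → Joined x y
    include b q r = b , q , orb-closed (Side.KB-invs b) r q , Side.KB⇒K b r
    split : ∀ {x} → InE G x → (∃ λ z → InM true z × Joined x z) ⊎ (∃ λ z → InM false z × Joined x z)
    split {x} p = pickSide (A (edgeOf x)) (mask-cover _ p)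
      where
      pickSide : ∀ b → InM b x → (∃ λ z → InM true z × Joined x z) ⊎ (∃ λ z → InM false z × Joined x z)
      pickSide true  q = inj₁ (x , q , joined-refl p)
      pickSide false q = inj₂ (x , q , joined-refl p)

  Shared : Flag (m G) → Set
  Shared x = InE G x × (∀ b → Touch (T ∘ mask b) x)

  -- A vertex with a flag meets the side of that flag, so it cannot be missed by both sides: it is
  -- shared, or missed by exactly one.
  vertex-classes : ∀ {d} → HasClasses V Shared d →
    HasClasses V (InE G) (d + (isolatedBy G (mask true) + isolatedBy G (mask false)))
  vertex-classes h = classes-⊎ _◅◅_ proj₁ proj₁ (λ _ _ → id) (λ _ _ → id)
    (λ (_ , f) (_ , b , n) r → n (touch-resp r (f b)))
    (λ _ → id) (λ _ → id) split h
    (classes-⊎ {P = λ x → InE G x × ∃ λ b → ¬ Touch (T ∘ mask b) x} _◅◅_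
      (λ (p , n) → p , true , n) (λ (p , n) → p , false , n) (λ _ _ → id) (λ _ _ → id)
      (λ {x} (p , n) (_ , n') r → neither x p (λ { true → n ; false → n' ∘ touch-resp r }))
      (λ _ → id) (λ _ → id)
      (λ { {x} (p , true , n) → inj₁ (x , (p , n) , ε) ; {x} (p , false , n) → inj₂ (x , (p , n) , ε) })
      (isolated-classes (mask true)) (isolated-classes (mask false)))
    where
    neither : ∀ x → InE G x → ¬ (∀ b → ¬ Touch (T ∘ mask b) x)
    neither x p n = n (A (edgeOf x)) (touch-self (mask-cover _ p))
    split : ∀ {x} → InE G x →
      (∃ λ z → Shared z × V x z) ⊎ (∃ λ z → (InE G z × ∃ λ b → ¬ Touch (T ∘ mask b) z) × V x z)
    split {x} p with Side.touch? true {x} p | Side.touch? false {x} p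
    ... | yes h | yes h' = inj₁ (x , (p , λ { true → h ; false → h' }) , ε)
    ... | no n  | _      = inj₂ (x , (p , true , n) , ε)
    ... | yes _ | no n   = inj₂ (x , (p , false , n) , ε)

  -- Counting shared vertices along an ordering of the components

  module Family {l} (tag : Fin l → Bool) (H : Fin l → EdgeSet (m G))
    (component : ∀ i → IsComponent G (mask (tag i)) (H i))
    (distinct : ∀ i j → i ≢ j → ∀ e → ¬ (T (H i e) × T (H j e)))
    (covering : ∀ e → T (E G e) → ∃ λ i → T (H i e)) where

    H⊆mask : ∀ i e → T (H i e) → T (mask (tag i) e)
    H⊆mask i = proj₁ (proj₂ (component i))

    H-closed : ∀ i {x y} → T (H i (edgeOf x)) → InM (tag i) y → K (tag i) x y → T (H i (edgeOf y))
    H-closed i {x} {y} h q r = Equivalence.from (proj₂ (proj₂ (component i)) (edgeOf x) (edgeOf y) h q)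
      (Equivalence.from (Reach⇔Orb G (Side.K-invs (tag i)) (mask⊆E (tag i) _ (H⊆mask i _ h)))
        (Side.K-sym (tag i) (K-base (tag i) x (H⊆mask i _ h)) ◅◅ r ◅◅ K-base (tag i) y q))

    H-joined : ∀ i {x y} → T (H i (edgeOf x)) → T (H i (edgeOf y)) → Joined x y
    H-joined i {x} {y} h h' = tag i , H⊆mask i _ h , H⊆mask i _ h' ,
      (K-base (tag i) x (H⊆mask i _ h) ◅◅
       Equivalence.to (Reach⇔Orb G (Side.K-invs (tag i)) (mask⊆E (tag i) _ (H⊆mask i _ h)))
         (Equivalence.to (proj₂ (proj₂ (component i)) (edgeOf x) (edgeOf y) h (H⊆mask i _ h')) h')
       ◅◅ Side.K-sym (tag i) (K-base (tag i) y (H⊆mask i _ h')))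

    H-unique : ∀ i j e → T (H i e) → T (H j e) → i ≡ j
    H-unique i j e h h' with i ≟ᶠ j
    ... | yes eq = eq
    ... | no n   = ⊥-elim (distinct i j n e (h , h'))

    -- A component contains, with one of its flags, every edge of its side at the same vertex; hence
    -- each vertex meets at most one summand of each tag. The count of shared vertices rests on
    -- this.
    same-tag : ∀ {i j x} → Touch (T ∘ H i) x → Touch (T ∘ H j) x → tag i ≡ tag j → i ≡ j
    same-tag {i} {j} (y , r , h) (z , s , h') eq = H-unique i j (edgeOf z)
      (H-closed i h (subst (λ b → InM b z) (sym eq) (H⊆mask j _ h')) (Side.V⊆K (tag i) (V-sym r ◅◅ s))) h'

    family-classes : HasClasses Joined (InE G) l
    family-classes = record
      { reps = tabulate rep
      ; size = length-tabulate rep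
      ; inP = All.tabulate⁺ λ i → mask⊆E (tag i) _ (H⊆mask i _ (in-rep i))
      ; apart = AllPairs.tabulate⁺ λ {i} {j} i≢j r → i≢j (apart' i j r)
      ; cover = λ {x} p → let i , h = covering (edgeOf x) p in
          Any.tabulate⁺ {f = rep} i (H-joined i {x} {rep i} h (in-rep i))
      }
      where
      rep : Fin l → Flag (m G)
      rep i = base (proj₁ (proj₁ (component i)))
      in-rep : ∀ i → T (H i (edgeOf (rep i)))
      in-rep i = proj₂ (proj₁ (component i))
      apart' : ∀ i j → Joined (rep i) (rep j) → i ≡ j
      apart' i j (b , q , q' , r) with mask-unique b (tag i) (edgeOf (rep i)) q (H⊆mask i _ (in-rep i))
      ... | refl = H-unique i j _ (H-closed i {rep i} {rep j} (in-rep i) q' r) (in-rep j)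

    U : ℕ → Fin (m G) → Set
    U n e = ∃ λ j → toℕ j < n × T (H j e)

    union : Fin l → EdgeSet (m G)
    union i e = any (λ j → (toℕ j <ᵇ toℕ i) ∧ H j e) (allFin l)

    common : Fin l → ℕ
    common i = commonVertices G (union i) (H i)

    Common : Fin l → Flag (m G) → Set
    Common i x = InE G x × Touch (U (toℕ i)) x × Touch (T ∘ H i) x

    union⇔U : ∀ i e → T (union i e) ⇔ U (toℕ i) e
    union⇔U i e = mk⇔ to from
      where
      to : T (union i e) → U (toℕ i) e
      to h = let j , _ , h' = find (Any.any⁻ (λ j → (toℕ j <ᵇ toℕ i) ∧ H j e) (allFin l) h)
                 lt , hj = Equivalence.to T-∧ h'
             in j , <ᵇ⇒< (toℕ j) (toℕ i) lt , hj
      from : U (toℕ i) e → T (union i e)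
      from (j , lt , h) = Any.any⁺ _ (lose (∈-allFin j) (Equivalence.from T-∧ (<⇒<ᵇ lt , h)))

    Common-classes : ∀ i → HasClasses V (Common i) (common i)
    Common-classes i = classes-P
      (λ (p , u , h) → p , touch-map {T ∘ union i} {U (toℕ i)} (λ {e} → Equivalence.to (union⇔U i e)) u , h)
      (λ (p , u , h) → p , touch-map {U (toℕ i)} {T ∘ union i} (λ {e} → Equivalence.from (union⇔U i e)) u , h)
      (common-classes (union i) (H i))

    Shared< : ℕ → Flag (m G) → Set
    Shared< n x = InE G x × (∀ b → Touch (λ e → U n e × T (mask b e)) x)

    U-suc : ∀ i {e} → U (suc (toℕ i)) e → U (toℕ i) e ⊎ T (H i e)
    U-suc i (j , s≤s le , h) with m≤n⇒m<n∨m≡n le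
    ... | inj₁ lt = inj₁ (j , lt , h)
    ... | inj₂ eq with toℕ-injective eq
    ...   | refl = inj₂ h

    other-tag : ∀ {i j x} → toℕ j < toℕ i → Touch (T ∘ H j) x → Touch (T ∘ H i) x → tag j ≢ tag i
    other-tag lt hj hi eq = <-irrefl (cong toℕ (same-tag hj hi eq)) lt

    -- A vertex of `H i` meets no earlier summand of the same tag, so it was not shared before. It
    -- becomes shared exactly when an earlier summand, necessarily of the other tag, meets it.
    shared-step : ∀ i {n} → HasClasses V (Shared< (toℕ i)) n → HasClasses V (Shared< (suc (toℕ i))) (n + common i)
    shared-step i h = classes-⊎ _◅◅_
      (λ (p , f) → p , λ b → touch-map (λ ((j , lt , hj) , q) → (j , m≤n⇒m≤1+n lt , hj) , q) (f b))
      new (λ _ _ → id) (λ _ _ → id) disjoint (λ _ → id) (λ _ → id) split h (Common-classes i)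
      where
      new : ∀ {x} → Common i x → Shared< (suc (toℕ i)) x
      new {x} (p , (y , r , (j , lt , hj)) , (z , s , hi)) = p , λ b → choose b (b ≟ᵇ tag i)
        where
        choose : ∀ b → Dec (b ≡ tag i) → Touch (λ e → U (suc (toℕ i)) e × T (mask b e)) x
        choose b (yes refl) = z , s , (i , ≤-refl , hi) , H⊆mask i _ hi
        choose b (no n) with trans (¬-not n) (sym (¬-not (other-tag lt (y , r , hj) (z , s , hi))))
        -- Both `b` and `tag j` differ from `tag i`, hence they agree.
        ... | refl = y , r , (j , m≤n⇒m≤1+n lt , hj) , H⊆mask j _ hj
      disjoint : ∀ {x y} → Shared< (toℕ i) x → Common i y → ¬ V x y
      disjoint (p , f) (_ , _ , hi) r with f (tag i)
      ... | z , s , (j , lt , hj) , q = other-tag lt (touch-resp r (z , s , hj)) hi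
        (mask-unique (tag j) (tag i) (edgeOf z) (H⊆mask j _ hj) q)
      split : ∀ {x} → Shared< (suc (toℕ i)) x →
        (∃ λ z → Shared< (toℕ i) z × V x z) ⊎ (∃ λ z → Common i z × V x z)
      split {x} (p , f) with f (tag i)
      ... | z , s , u , q with U-suc i u
      ...   | inj₁ u' = inj₁ (x , (p , λ b → older b (b ≟ᵇ tag i)) , ε)
        where
        older : ∀ b → Dec (b ≡ tag i) → Touch (λ e → U (toℕ i) e × T (mask b e)) x
        older b (yes refl) = z , s , u' , q
        older b (no n) with f b
        ... | z' , s' , v , q' with U-suc i v
        ...   | inj₁ v' = z' , s' , v' , q'
        ...   | inj₂ hi = ⊥-elim (n (mask-unique b (tag i) (edgeOf z') q' (H⊆mask i _ hi)))
      -- `H i` supplies the flag on its own side; the flag on the other side must come from an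
      -- earlier summand, so the vertex is common.
      ...   | inj₂ hi with f (not (tag i))
      ...     | z' , s' , v , q' with U-suc i v
      ...       | inj₁ v' = inj₂ (x , (p , (z' , s' , v') , (z , s , hi)) , ε)
      ...       | inj₂ hi' = ⊥-elim (not-¬ refl (mask-unique (tag i) (not (tag i)) (edgeOf z') (H⊆mask i _ hi') q'))

    shared-zero : HasClasses V (Shared< 0) 0
    shared-zero = classes-empty λ { (p , f) → none (f true) }
      where
      none : ∀ {x} → ¬ Touch (λ e → U 0 e × T (mask true e)) x
      none (_ , _ , (_ , () , _) , _)

    shared-all : ∀ {n} → HasClasses V (Shared< l) n → HasClasses V Shared n
    shared-all = classes-P
      (λ (p , f) → p , λ b → touch-map proj₂ (f b))
      (λ (p , f) → p , λ b → touch-map (λ {e} q → (let j , h = covering e (mask⊆E b e q) in j , toℕ<n j , h) , q) (f b))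

    common-first : ∀ i → toℕ i ≡ 0 → common i ≡ 0
    common-first i eq = classes-empty⁻ none (Common-classes i)
      where
      none : ∀ {x} → ¬ Common i x
      none (_ , (_ , _ , (j , lt , _)) , _) = n≮0 (subst (toℕ j <_) eq lt)

    -- The term of index 0 vanishes and every later term is 1; `pred` also covers the empty
    -- sequence.
    shared-count : (∀ i → 0 < toℕ i → common i ≡ 1) → ∀ n → n ≤ l → HasClasses V (Shared< n) (pred n)
    shared-count one zero le = shared-zero
    shared-count one (suc n) le with fromℕ< le | toℕ-fromℕ< le | shared-count one n (≤-trans (n≤1+n n) le)
    ... | i | refl | h = subst (HasClasses V (Shared< (suc (toℕ i)))) (count (toℕ i) refl) (shared-step i h)
      where
      count : ∀ k → toℕ i ≡ k → pred k + common i ≡ k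
      count zero eq = common-first i eq
      count (suc k) eq = trans (cong (k +_) (one i (subst (0 <_) (sym eq) (s≤s z≤n)))) (+-comm k 1)

    -- The last clause says when the lower bound is attained. It is carried through the induction
    -- because excess in one term cannot be made up for by another.
    shared-bound : (∀ i → 0 < toℕ i → 1 ≤ common i) → ∀ n → n ≤ l → ∃ λ s →
      HasClasses V (Shared< n) s × pred n ≤ s × (s ≤ pred n → ∀ i → 0 < toℕ i → toℕ i < n → common i ≡ 1)
    shared-bound one zero le = 0 , shared-zero , z≤n , λ _ _ _ ()
    shared-bound one (suc n) le with fromℕ< le | toℕ-fromℕ< le | shared-bound one n (≤-trans (n≤1+n n) le)
    ... | i | refl | s , h , lo , tight = s + common i , shared-step i h , bound (toℕ i) refl lo , rest (toℕ i) refl lo tight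
      where
      pos-i : ∀ {k} → toℕ i ≡ suc k → 0 < toℕ i
      pos-i eq = subst (0 <_) (sym eq) (s≤s z≤n)
      bound : ∀ k → toℕ i ≡ k → pred k ≤ s → k ≤ s + common i
      bound zero eq lo = z≤n
      bound (suc k) eq lo = ≤-trans (≤-reflexive (+-comm 1 k)) (+-mono-≤ lo (one i (pos-i eq)))
      rest : ∀ k → toℕ i ≡ k → pred k ≤ s →
        (s ≤ pred k → ∀ j → 0 < toℕ j → toℕ j < k → common j ≡ 1) →
        s + common i ≤ k → ∀ j → 0 < toℕ j → toℕ j < suc k → common j ≡ 1
      rest zero eq lo tight le' j 0<j (s≤s j<1) = contradiction (≤-trans 0<j j<1) λ ()
      rest (suc k) eq lo tight le' j 0<j (s≤s j≤) with m≤n⇒m<n∨m≡n j≤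
      -- The term of `i` takes at least one unit of the bound, which leaves `s ≤ k` for the earlier
      -- terms.
      ... | inj₁ lt = tight (≤-pred (≤-trans (≤-reflexive (+-comm 1 s)) (≤-trans (+-monoʳ-≤ s (one i (pos-i eq))) le'))) j 0<j lt
      ... | inj₂ j≡ with toℕ-injective (trans j≡ (sym eq))
      -- The earlier terms take at least `k` of the `suc k` units, so one is left for `i`.
      ...   | refl = ≤-antisym (+-cancelˡ-≤ k _ 1 (≤-trans (+-monoˡ-≤ _ lo) (≤-trans le' (≤-reflexive (+-comm 1 k))))) (one i 0<j)

    -- Gluing colourings along single vertices

    module _ (one-sum : ∀ i → 0 < toℕ i → common i ≡ 1)
      (col : Bool → Flag (m G) → Bool)
      (col-V : ∀ b {x} → InE G x → Touch (T ∘ mask b) x →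
        col b (t x) ≡ not (col b x) × col b (θ₂ x) ≡ not (col b x))
      (col-θ₀ : ∀ b {x} → InM b x → col b (θ₀ x) ≡ not (col b x)) where

      private
        Coloured : ℕ → Set
        Coloured n = ∃ λ (c : Flag (m G) → Bool) →
          (∀ {x} → InE G x → Touch (U n) x → c (t x) ≡ not (c x) × c (θ₂ x) ≡ not (c x)) ×
          (∀ {x} → U n (edgeOf x) → c (θ₀ x) ≡ not (c x))

        xor-not-not : ∀ {a a' b b'} → a' ≡ not a → b' ≡ not b → a' xor b' ≡ a xor b
        xor-not-not {true}  {b = true}  refl refl = refl
        xor-not-not {true}  {b = false} refl refl = refl
        xor-not-not {false} {b = true}  refl refl = refl
        xor-not-not {false} {b = false} refl refl = refl

        xor-move : ∀ a b o → a xor b ≡ o → a ≡ o xor b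
        xor-move true  true  _ refl = refl
        xor-move true  false _ refl = refl
        xor-move false true  _ refl = refl
        xor-move false false _ refl = refl

        xor-not : ∀ o {b b'} → b' ≡ not b → o xor b' ≡ not (o xor b)
        xor-not true  refl = refl
        xor-not false refl = refl

        -- Both colourings alternate at the only common vertex, so their `xor` is constant there.
        -- Shifting the colouring of the side by this constant makes the two agree where they
        -- overlap.
        extend : ∀ i → Coloured (toℕ i) → Coloured (suc (toℕ i))
        extend i (c , c-V , c-θ₀) = c' , c'-V , c'-θ₀
          where
          d = col (tag i)
          d-V : ∀ {x} → InE G x → Touch (T ∘ H i) x → d (t x) ≡ not (d x) × d (θ₂ x) ≡ not (d x)
          d-V p h = col-V (tag i) p (touch-map {T ∘ H i} {T ∘ mask (tag i)} (λ {e} → H⊆mask i e) h)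
          common-resp : ∀ {x y} → V x y → Common i x → Common i y
          common-resp r (p , u , h) = orb-closed V-invs r p , touch-resp r u , touch-resp r h
          agree : ∀ {x y} → V x y → Common i x → c y xor d y ≡ c x xor d x
          agree ε k = refl
          agree {x} ((p , here refl) ◅ s) k@(_ , u , h) = trans (agree s (common-resp (V-t p) k))
            (xor-not-not (proj₁ (c-V {x} p u)) (proj₁ (d-V {x} p h)))
          agree {x} ((p , there (here refl)) ◅ s) k@(_ , u , h) = trans (agree s (common-resp (V-θ₂ p) k))
            (xor-not-not (proj₂ (c-V {x} p u)) (proj₂ (d-V {x} p h)))
          offset : ∃ λ o → ∀ {y} → Common i y → c y ≡ o xor d y
          offset = choose (toℕ i) refl
            where
            choose : ∀ n → toℕ i ≡ n → ∃ λ o → ∀ {y} → Common i y → c y ≡ o xor d y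
            -- The first summand meets nothing earlier, so the offset is arbitrary.
            choose zero eq = false , λ k → contradiction (classes-nonempty k (Common-classes i))
              (subst (λ n → ¬ 1 ≤ n) (sym (common-first i eq)) λ ())
            choose (suc n) eq =
              let one = one-sum i (subst (0 <_) (sym eq) (s≤s z≤n))
                  r , k = classes-witness (≤-reflexive (sym one)) (Common-classes i)
              in c r xor d r , λ {y} k' → xor-move (c y) (d y) _
                (agree (classes-single V-sym _◅◅_ (≤-reflexive one) (Common-classes i) k k') k)
          o = proj₁ offset
          old? : Flag (m G) → Bool
          old? x = any (λ y → RV G x y ∧ union i (edgeOf y)) (flags G)
          -- The old colour is kept at every vertex that the union meets; by `c'-new` this agrees
          -- with the shifted colour at the vertices of `H i`.
          c' : Flag (m G) → Bool
          c' x = if old? x then c x else o xor d x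
          old⇔ : ∀ {x} → InE G x → T (old? x) ⇔ Touch (U (toℕ i)) x
          old⇔ {x} p = mk⇔
            (λ h → touch-map {T ∘ union i} {U (toℕ i)} (λ {e} → Equivalence.to (union⇔U i e)) (Equivalence.to (touch⇔ {union i} {x} p) h))
            (λ h → Equivalence.from (touch⇔ {union i} {x} p) (touch-map {U (toℕ i)} {T ∘ union i} (λ {e} → Equivalence.from (union⇔U i e)) h))
          c'-old : ∀ {x} → InE G x → Touch (U (toℕ i)) x → c' x ≡ c x
          c'-old {x} p u with old? x | Equivalence.from (old⇔ {x} p) u
          ... | true | _ = refl
          c'-new : ∀ {x} → InE G x → Touch (T ∘ H i) x → c' x ≡ o xor d x
          c'-new {x} p h with old? x | Equivalence.to (old⇔ {x} p)
          ... | true  | f = proj₂ offset (p , f tt , h)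
          ... | false | _ = refl
          c'-V : ∀ {x} → InE G x → Touch (U (suc (toℕ i))) x → c' (t x) ≡ not (c' x) × c' (θ₂ x) ≡ not (c' x)
          c'-V {x} p (y , r , u) with U-suc i u
          ... | inj₁ u' rewrite c'-old {x} p (y , r , u') | c'-old {t x} (θ₁-closed x p) (touch-resp (V-t p) (y , r , u'))
                              | c'-old {θ₂ x} p (touch-resp (V-θ₂ p) (y , r , u')) = c-V p (y , r , u')
          ... | inj₂ h rewrite c'-new {x} p (y , r , h) | c'-new {t x} (θ₁-closed x p) (touch-resp (V-t p) (y , r , h))
                             | c'-new {θ₂ x} p (touch-resp (V-θ₂ p) (y , r , h)) =
            let a , b = d-V {x} p (y , r , h) in xor-not o a , xor-not o b
          c'-θ₀ : ∀ {x} → U (suc (toℕ i)) (edgeOf x) → c' (θ₀ x) ≡ not (c' x)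
          c'-θ₀ {x} u with U-suc i u
          ... | inj₁ u'@(j , _ , h) rewrite c'-old {x} (mask⊆E (tag j) _ (H⊆mask j _ h)) (touch-self u')
                                          | c'-old {θ₀ x} (mask⊆E (tag j) _ (H⊆mask j _ h)) (touch-self u') = c-θ₀ u'
          ... | inj₂ h rewrite c'-new {x} (mask⊆E (tag i) _ (H⊆mask i _ h)) (touch-self h)
                             | c'-new {θ₀ x} (mask⊆E (tag i) _ (H⊆mask i _ h)) (touch-self h) =
            xor-not o (col-θ₀ (tag i) (H⊆mask i _ h))

        colour : ∀ n → n ≤ l → Coloured n
        colour zero le = (λ _ → true) , (λ { _ (_ , _ , _ , () , _) }) , λ { (_ , () , _) }
        colour (suc n) le with fromℕ< le | toℕ-fromℕ< le | colour n (≤-trans (n≤1+n n) le)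
        ... | i | refl | c = extend i c

      glue-colourings : Orientable G
      glue-colourings = let c , c-V , c-θ₀ = colour l ≤-refl in c , λ x p →
        let i , h = covering (edgeOf x) p
            u = i , toℕ<n i , h
            a , b = c-V {x} p (touch-self u)
        in (λ eq → not-¬ eq (c-θ₀ {x} u)) , (λ eq → not-¬ eq a) , λ eq → not-¬ eq b

  -- An ordering of the components in which each one meets an earlier one

  Share : Flag (m G) → Flag (m G) → Set
  Share r s = ∃ λ y → ∃ λ z → Joined r y × Joined s z × V y z

  module _ (connected : ∀ {x y} → InE G x → InE G y → Conn x y) where

    Near : List (Flag (m G)) → Flag (m G) → Set
    Near done x = ∃ λ y → V x y × Any (Joined y) done

    -- The order in which a search of `G` reaches the components; `acc` accumulates those already
    -- reached.
    data Chain (acc : List (Flag (m G))) : List (Flag (m G)) → Set where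
      []  : Chain acc []
      _∷_ : ∀ {r L} → Any (Share r) acc → Chain (r ∷ acc) L → Chain acc (r ∷ L)

    chain-lookup : ∀ {acc L} → Chain acc L → ∀ i →
      Any (Share (lookup L i)) acc ⊎ ∃ λ j → toℕ j < toℕ i × Share (lookup L i) (lookup L j)
    chain-lookup (a ∷ c) zero = inj₁ a
    chain-lookup (a ∷ c) (suc i) with chain-lookup c i
    ... | inj₁ (here s)       = inj₂ (zero , s≤s z≤n , s)
    ... | inj₁ (there b)      = inj₁ b
    ... | inj₂ (j , lt , s)   = inj₂ (suc j , s≤s lt , s)

    -- Along a path of `G` the vertex can change only at `θ₀`. The edge crossed there lies in a
    -- listed component, or in an unlisted one that shares the current vertex with a listed one; in
    -- the latter case the search has found its next entry.
    walk : ∀ {done todo} → (∀ {x} → InE G x → Any (Joined x) (done ++ todo)) → ∀ {x y} → Conn x y →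
      Near done x → Near done y ⊎ Any (λ r → Any (Share r) done) todo
    walk cov ε near = inj₁ near
    walk {done} cov {x} ((p , here refl) ◅ s) (y , v , a) with Any.++⁻ done (cov p)
    ... | inj₁ b = walk cov s (θ₀ x , ε , Any.map (joined-trans back) b)
      where
      q = mask-cover (edgeOf x) p
      back : Joined (θ₀ x) x
      back = A (edgeOf x) , q , q , Side.K-sym (A (edgeOf x)) (Side.K-θ₀ (A (edgeOf x)) q)
    ... | inj₂ b = inj₂ (Any.map (λ jr → Any.map (λ jy → x , y , joined-sym jr , joined-sym jy , v) a) b)
    walk cov ((p , there (here refl)) ◅ s) (y , v , a) = walk cov s (y , V-sym (V-t p) ◅◅ v , a)
    walk cov ((p , there (there (here refl))) ◅ s) (y , v , a) = walk cov s (y , V-sym (V-θ₂ p) ◅◅ v , a)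

    order : ∀ n {s done} todo → length todo ≡ n → InE G s → s ∈ done → All (InE G) todo →
      (∀ {x} → InE G x → Any (Joined x) (done ++ todo)) → ∃ λ L → L ↭ todo × Chain done L
    order n [] len p s∈ ps cov = [] , ↭-refl , []
    order (suc n) {s} {done} (r ∷ rest) len p s∈ ps@(pr ∷ _) cov with find next
      where
      next : Any (λ r → Any (Share r) done) (r ∷ rest)
      next with walk cov (connected p pr) (s , ε , lose s∈ (joined-refl p))
      ... | inj₂ a = a
      -- The path arrived at a vertex of a listed component, so `r` itself shares that vertex with
      -- it.
      ... | inj₁ (y , v , a) = here (Any.map (λ jy → r , y , joined-refl pr , joined-sym jy , v) a)
    ... | r' , r'∈ , sh with ∈-∃++ r'∈
    ...   | ys , zs , eq = let L , perm , ch = ih in r' ∷ L , ↭-trans (prep r' perm) (↭-sym todo↭) , sh ∷ ch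
      where
      todo↭ : r ∷ rest ↭ r' ∷ ys ++ zs
      todo↭ = ↭-trans (↭-reflexive eq) (shift r' ys zs)
      ih = order n {s} {r' ∷ done} (ys ++ zs) (suc-injective (trans (sym (↭-length todo↭)) len)) p (there s∈)
        (All.tail (All-resp-↭ todo↭ ps))
        (λ q → Any-resp-↭ (↭-trans (++⁺ˡ done todo↭) (shift r' done (ys ++ zs))) (cov q))

    reorder : ∀ {n} → HasClasses Joined (InE G) n → Σ (HasClasses Joined (InE G) n) λ h →
      ∀ i → 0 < toℕ i → ∃ λ j → toℕ j < toℕ i × Share (lookup (reps h) i) (lookup (reps h) j)
    reorder h with reps h in eq | inP h | cover h
    ... | [] | _ | _ = h , subst (λ L → ∀ i → 0 < toℕ i → ∃ λ j → toℕ j < toℕ i × Share (lookup L i) (lookup L j))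
      (sym eq) λ ()
    ... | r ∷ rest | p ∷ ps | cov with order (length rest) rest refl p (here refl) ps cov
    ...   | L , perm , ch = record
      { reps = r ∷ L
      ; size = trans (↭-length perm') (size h)
      ; inP = All-resp-↭ (↭-sym perm') (inP h)
      ; apart = apart-resp-↭ joined-sym (↭-sym perm') (apart h)
      ; cover = Any-resp-↭ (↭-sym perm') ∘ cover h
      } , earlier
      where
      perm' : r ∷ L ↭ reps h
      perm' = ↭-trans (prep r perm) (↭-reflexive (sym eq))
      earlier : ∀ i → 0 < toℕ i → ∃ λ j → toℕ j < toℕ i × Share (lookup (r ∷ L) i) (lookup (r ∷ L) j)
      earlier (suc i) _ with chain-lookup ch i
      ... | inj₁ (here s) = zero , s≤s z≤n , s
      ... | inj₂ (j , lt , s) = suc j , s≤s lt , s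

-- The genus equation and biseparations

module Balance (G : RibbonGraph) (wf : WF G) (conn : Connected G) (A : EdgeSet (m G))
  (A⊆E : ∀ e → T (A e) → T (E G e)) where
  open Vertices G wf
  open Dual G wf A
  open Components G wf A

  k k₁ k₂ v₁ v₂ f₁ f₂ w₁ w₂ : ℕ
  k  = countOrbits G (θ₀ ∷ t ∷ θ₂ ∷ [])
  k₁ = countOrbits On.sub (θ₀ ∷ θ₁ On.sub ∷ θ₂ ∷ [])
  k₂ = countOrbits Off.sub (θ₀ ∷ θ₁ Off.sub ∷ θ₂ ∷ [])
  v₁ = countOrbits On.sub (θ₁ On.sub ∷ θ₂ ∷ [])
  v₂ = countOrbits Off.sub (θ₁ Off.sub ∷ θ₂ ∷ [])
  f₁ = countOrbits On.sub (θ₀ ∷ θ₁ On.sub ∷ [])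
  f₂ = countOrbits Off.sub (θ₀ ∷ θ₁ Off.sub ∷ [])
  w₁ = isolatedBy G (mask true)
  w₂ = isolatedBy G (mask false)

  -- Apart from isolated vertices of `G`, which have cancelled, these are the components of the two
  -- spanning subgraphs against the vertices. As `G` is connected, `k` is 1, or 0 if `G` is a single
  -- isolated vertex.
  Balanced : Set
  Balanced = (k₁ + w₁) + (k₂ + w₂) ≡ (v₁ + w₁) + k

  genus : ℕ → ℕ → ℕ → ℕ → ℤ
  genus k v e f = ((pos (2 * k) -ℤ pos v) +ℤ pos e) -ℤ pos f

  genus-cong : ∀ {k k' v v' e e' f f'} → k ≡ k' → v ≡ v' → e ≡ e' → f ≡ f' → genus k v e f ≡ genus k' v' e' f'
  genus-cong refl refl refl refl = refl

  genus⇔balanced : (γ (G ^ A) ≡ γ (G ∣ A) +ℤ γ (G ⊖ A)) ⇔ Balanced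
  genus⇔balanced = mk⇔ (λ eq → Equivalence.to bal (trans (sym dual) eq)) (λ eq → trans dual (Equivalence.from bal eq))
    where
    dual : γ (G ^ A) ≡ genus (k + nIso G) (f₁ + w₁ + nIso G) (#E (G ∣ A) + #E (G ⊖ A)) (f₂ + w₂ + nIso G)
    dual = genus-cong
      (cong (_+ nIso G) (classes-unique (orb-sym Conn-invs) _◅◅_ dual-K-classes Conn-classes))
      (cong (_+ nIso G) (classes-unique (orb-sym On.F-invs) _◅◅_ dual-V-classes On.sub-F-classes))
      (sym #E-split)
      (cong (_+ nIso G) (classes-unique (orb-sym Off.F-invs) _◅◅_ dual-F-classes Off.sub-F-classes))
    bal = genus-balance {nIso G} {k} {v₁} {f₁} {k₁} {#E (G ∣ A)} {w₁} {v₂} {f₂} {k₂} {#E (G ⊖ A)} {w₂}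
      (classes-unique V-sym _◅◅_ On.sub-V-classes Off.sub-V-classes)

  inhabited? : (∃ λ x → InE G x) ⊎ (∀ {x} → ¬ InE G x)
  inhabited? with flags G | flags-InE G | (λ {x} → ∈-flags G {x})
  ... | []    | _     | all = inj₂ λ {x} p → case-[] (all {x} p)
    where
    case-[] : ∀ {x : Flag (m G)} → ¬ x ∈ []
    case-[] ()
  ... | x ∷ _ | p ∷ _ | _   = inj₁ (x , p)

  empty⇒balanced : (∀ {x} → ¬ InE G x) → Balanced
  empty⇒balanced none = trans
    (cong₂ _+_ (classes-empty⁻ (λ {x} → none {x}) On.sub-K-classes) (classes-empty⁻ (λ {x} → none {x}) Off.sub-K-classes))
    (sym (cong₂ _+_ (classes-empty⁻ (λ {x} → none {x}) On.sub-V-classes) (classes-empty⁻ (λ {x} → none {x}) Conn-classes)))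

  k≤1 : k ≤ 1
  k≤1 = ≤-trans (m≤m+n k (nIso G)) (≤-reflexive conn)

  connected : ∀ {x y} → InE G x → InE G y → Conn x y
  connected = classes-single (orb-sym Conn-invs) _◅◅_ k≤1 Conn-classes

  K⊆Conn : ∀ b {x y} → K b x y → Conn x y
  K⊆Conn b = orb-⊆ ε _◅◅_ ((λ p → orb-step (there (here refl)) p) ∷ (λ p → orb-step (there (there (here refl))) p)
    ∷ (λ {x} p → σ-step x p) ∷ [])
    where
    σ-step : ∀ x → InE G x → Conn x (Side.σ b x)
    σ-step x p with mask b (edgeOf x)
    ... | true  = orb-step (here refl) p
    ... | false = ε

  full⇒k : ∀ b → (∀ e → T (E G e) → T (mask b e)) → ∀ {n} → HasClasses (K b) (InE G) n → n ≡ k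
  full⇒k b full h = classes-unique (orb-sym Conn-invs) _◅◅_
    (classes-⇔ _◅◅_ ε (K⊆Conn b) (λ _ → Conn⊆K) h) Conn-classes
    where
    Conn⊆K : ∀ {x y} → Conn x y → K b x y
    Conn⊆K = orb-⊆ ε _◅◅_ ((λ p → Side.K-θ₀ b (full _ p)) ∷ (λ p → Side.V⊆K b (V-t p)) ∷ (λ p → Side.V⊆K b (V-θ₂ p)) ∷ [])

  -- With no edge to cross, every vertex is its own component. Together with `full⇒k` this settles
  -- the two trivial biseparations, which come without a sequence of 1-sums.
  empty⇒v : ∀ b → (∀ e → ¬ T (mask b e)) → ∀ {n} → HasClasses (K b) (InE G) n → n ≡ v₁ + w₁
  empty⇒v b none h = classes-unique V-sym _◅◅_ (classes-⇔ _◅◅_ ε K⊆V (λ _ → Side.V⊆K b) h) On.sub-V-classes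
    where
    K⊆V : ∀ {x y} → K b x y → V x y
    K⊆V = orb-⊆ ε _◅◅_ ((λ p → V-t p) ∷ (λ p → V-θ₂ p)
      ∷ (λ {x} p → subst (V x) (sym (Side.onB-out b θ₀ id x (none (edgeOf x)))) ε) ∷ [])

  module _ (full : ∀ e → T (E G e) → T (A e)) where
    full-mask : ∀ e → T (E G e) → T (mask true e)
    full-mask e p = Equivalence.from T-∧ (p , full e p)

    full-none : ∀ e → ¬ T (mask false e)
    full-none e h = contradiction (mask-unique true false e (full-mask e (mask⊆E false e h)) h) λ ()

  module _ (none : ∀ e → ¬ T (A e)) where
    none-none : ∀ e → ¬ T (mask true e)
    none-none e h = none e (proj₂ (Equivalence.to (T-∧ {E G e}) h))

    none-mask : ∀ e → T (E G e) → T (mask false e)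
    none-mask e p with A e in eq
    ... | true  = ⊥-elim (none e (Equivalence.from T-≡ eq))
    ... | false = Equivalence.from T-∧ (p , tt)

  module Decomposition (D : OneSumDecomposition G A) where
    open OneSumDecomposition D public renaming (cover to edges-covered)
    open Family tag H summands-are-components distinct edges-covered public

    balanced : ∃ (InE G) → Balanced
    balanced (x , p) = arithmetic components≡l l≡1+d v≡
      where
      components≡l : k₁ + k₂ ≡ l
      components≡l = classes-unique joined-sym joined-trans component-classes family-classes
      -- There is at least one summand, namely the one containing the edge of `x`.
      l≡1+d : l ≡ suc (pred l)
      l≡1+d = positive (proj₁ (edges-covered (edgeOf x) p))
        where
        positive : ∀ {n} → Fin n → n ≡ suc (pred n)
        positive {suc _} _ = refl
      v≡ : v₁ + w₁ ≡ pred l + (w₁ + w₂)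
      v≡ = classes-unique V-sym _◅◅_ On.sub-V-classes (vertex-classes (shared-all (shared-count one-sum l ≤-refl)))
      k≡1 : k ≡ 1
      k≡1 = ≤-antisym k≤1 (classes-nonempty {x = x} p Conn-classes)
      arithmetic : ∀ {l d} → k₁ + k₂ ≡ l → l ≡ suc d → v₁ + w₁ ≡ d + (w₁ + w₂) → Balanced
      arithmetic {d = d} e₁ e₂ e₃ = trans
        (solve 4 (λ a b c d → (a :+ b) :+ (c :+ d) := (a :+ c) :+ (b :+ d)) refl k₁ w₁ k₂ w₂)
        (trans (cong (_+ (w₁ + w₂)) (trans e₁ e₂)) (trans (+-comm 1 (d + (w₁ + w₂))) (sym (cong₂ _+_ e₃ k≡1))))
        where open Data.Nat.Solver.+-*-Solver

  biseparation⇒balanced : Biseparation G A → Balanced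
  biseparation⇒balanced (inj₁ full) = trans
    (cong₂ _+_ (full⇒k true (full-mask full) On.sub-K-classes) (empty⇒v false (full-none full) Off.sub-K-classes))
    (+-comm k (v₁ + w₁))
  biseparation⇒balanced (inj₂ (inj₁ none)) =
    cong₂ _+_ (empty⇒v true (none-none none) On.sub-K-classes) (full⇒k false (none-mask none) Off.sub-K-classes)
  biseparation⇒balanced (inj₂ (inj₂ D)) with inhabited?
  ... | inj₁ some = Decomposition.balanced D some
  ... | inj₂ none = empty⇒balanced (λ {x} → none {x})

  -- From balance to a sequence of 1-sums

  module Summands {n} (h : HasClasses Joined (InE G) n) where

    L : List (Flag (m G))
    L = reps h

    rep : Fin (length L) → Flag (m G)
    rep = lookup L

    rep-InE : ∀ i → InE G (rep i)
    rep-InE i = All.lookup (inP h) (∈-lookup i)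

    tag : Fin (length L) → Bool
    tag i = A (edgeOf (rep i))

    -- The component through `rep i`, computed by `Reach` since an `EdgeSet` is Boolean.
    H : Fin (length L) → EdgeSet (m G)
    H i e = mask (tag i) e ∧ Reach G (t ∷ θ₂ ∷ Side.σ (tag i) ∷ []) (rep i) (base e)

    rep-mask : ∀ i → InM (tag i) (rep i)
    rep-mask i = mask-cover _ (rep-InE i)

    H⁻ : ∀ i e → T (H i e) → T (mask (tag i) e) × K (tag i) (rep i) (base e)
    H⁻ i e p = let q , r = Equivalence.to T-∧ p in
      q , Equivalence.to (Reach⇔Orb G (Side.K-invs (tag i)) {rep i} {base e} (rep-InE i)) r

    H⁺ : ∀ i e → T (mask (tag i) e) → K (tag i) (rep i) (base e) → T (H i e)
    H⁺ i e q r = Equivalence.from T-∧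
      (q , Equivalence.from (Reach⇔Orb G (Side.K-invs (tag i)) {rep i} {base e} (rep-InE i)) r)

    H-joined⁻ : ∀ i e → T (H i e) → Joined (rep i) (base e)
    H-joined⁻ i e p = let q , r = H⁻ i e p in tag i , rep-mask i , q , r

    H-joined⁺ : ∀ i {x} → Joined (rep i) x → T (H i (edgeOf x))
    H-joined⁺ i {x} (b , q , q' , r) with mask-unique b (tag i) (edgeOf (rep i)) q (rep-mask i)
    ... | refl = H⁺ i (edgeOf x) q' (r ◅◅ K-base b x q')

    component : ∀ i → IsComponent G (mask (tag i)) (H i)
    component i = (edgeOf (rep i) , H⁺ i _ (rep-mask i) (K-base (tag i) (rep i) (rep-mask i))) ,
      (λ e p → proj₁ (H⁻ i e p)) ,
      λ e f p q → let q' , r = H⁻ i e p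
                      reach = Reach⇔Orb G (Side.K-invs (tag i)) {base e} {base f} (mask⊆E (tag i) e q')
                  in mk⇔ (λ p' → Equivalence.from reach (Side.K-sym (tag i) r ◅◅ proj₂ (H⁻ i f p')))
                         (λ c → H⁺ i f q (r ◅◅ Equivalence.to reach c))

    distinct : ∀ i j → i ≢ j → ∀ e → ¬ (T (H i e) × T (H j e))
    distinct i j i≢j e (p , q) = i≢j (apart⇒lookup-injective joined-sym (apart h) i j
      (joined-trans (H-joined⁻ i e p) (joined-sym (H-joined⁻ j e q))))

    covering : ∀ e → T (E G e) → ∃ λ i → T (H i e)
    covering e p = let a = cover h {base e} p in
      index a , H-joined⁺ (index a) {base e} (joined-sym (Any.lookup-index a))

    open Family tag H component distinct covering public

    share-touch : ∀ i j → Share (rep i) (rep j) → ∃ λ x → InE G x × Touch (T ∘ H j) x × Touch (T ∘ H i) x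
    share-touch i j (y , z , jy , jz , v) = y , proj₂ (joined-InE jy) ,
      (z , v , H-joined⁺ j jz) , touch-self {T ∘ H i} (H-joined⁺ i jy)

    module _ (earlier : ∀ i → 0 < toℕ i → ∃ λ j → toℕ j < toℕ i × Share (rep i) (rep j)) where

      common≥1 : ∀ i → 0 < toℕ i → 1 ≤ common i
      common≥1 i 0<i = let j , lt , s = earlier i 0<i
                           x , p , tj , ti = share-touch i j s
                       in classes-nonempty {x = x} (p , touch-map {T ∘ H j} {U (toℕ i)} (λ q → j , lt , q) tj , ti) (Common-classes i)

      -- Balance makes the number of shared vertices one less than the number of summands, the least
      -- value that positive terms allow, so every term is 1. The clause `mixed` comes from the
      -- order alone: an earlier summand sharing a vertex has the other tag.
      decomposition : Balanced → ∃ (InE G) → OneSumDecomposition G A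
      decomposition bal (x , p) = record
        { l = length L ; tag = tag ; H = H
        ; summands-are-components = component
        ; distinct = distinct
        ; cover = covering
        ; one-sum = λ i 0<i → tight s≤ i 0<i (toℕ<n i)
        ; mixed = λ i 0<i → let j , lt , sh = earlier i 0<i
                                y , q , tj , ti = share-touch i j sh
                            in j , lt , other-tag lt tj ti , classes-nonempty {x = y} (q , tj , ti) (common-classes (H j) (H i))
        }
        where
        bound = shared-bound common≥1 (length L) ≤-refl
        s = proj₁ bound
        tight = proj₂ (proj₂ (proj₂ bound))
        v≡ : v₁ + w₁ ≡ s + (w₁ + w₂)
        v≡ = classes-unique V-sym _◅◅_ On.sub-V-classes (vertex-classes (shared-all (proj₁ (proj₂ bound))))
        k≡1 : k ≡ 1
        k≡1 = ≤-antisym k≤1 (classes-nonempty {x = x} p Conn-classes)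
        l≡ : length L ≡ k₁ + k₂
        l≡ = trans (size h) (classes-unique joined-sym joined-trans h component-classes)
        l≡1+s : length L ≡ suc s
        l≡1+s = trans l≡ (+-cancelʳ-≡ (w₁ + w₂) (k₁ + k₂) (suc s) (trans
          (solve 4 (λ a b c d → (a :+ c) :+ (b :+ d) := (a :+ b) :+ (c :+ d)) refl k₁ w₁ k₂ w₂)
          (trans bal (trans (cong₂ _+_ v≡ k≡1) (+-comm (s + (w₁ + w₂)) 1)))))
          where open Data.Nat.Solver.+-*-Solver
        s≤ : s ≤ pred (length L)
        s≤ = ≤-reflexive (sym (cong pred l≡1+s))

  balanced⇒biseparation : Balanced → Biseparation G A
  balanced⇒biseparation bal with inhabited?
  -- Without flags `G` has no edge, and `A` is empty as a subset of `E G`.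
  ... | inj₂ none = inj₂ (inj₁ λ e a → none {base e} (A⊆E e a))
  ... | inj₁ some = let h , earlier = reorder connected component-classes in
    inj₂ (inj₂ (Summands.decomposition h earlier bal some))

  -- Every flag lies on the full side, so each vertex with flags meets it and the extended colouring
  -- is valid on all of `G`.
  orientable-full : ∀ b → (∀ e → T (E G e) → T (mask b e)) → Orientable (Side.sub b) → Orientable G
  orientable-full b full o = let d , d-V , d-θ₀ = Side.extend-colouring b o in d , λ x p →
    let a₁ , a₂ = d-V {x} p (touch-self {T ∘ mask b} (full _ p)) in
    (λ eq → not-¬ eq (d-θ₀ {x} (full _ p))) , (λ eq → not-¬ eq a₁) , λ eq → not-¬ eq a₂

  orientable-glued : Biseparation G A → Orientable On.sub → Orientable Off.sub → Orientable G
  orientable-glued (inj₁ full) o _ = orientable-full true (full-mask full) o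
  orientable-glued (inj₂ (inj₁ none)) _ o = orientable-full false (none-mask none) o
  orientable-glued (inj₂ (inj₂ D)) o o' = Decomposition.glue-colourings D (OneSumDecomposition.one-sum D)
    (λ b → proj₁ (ext b)) (λ b → proj₁ (proj₂ (ext b))) (λ b → proj₂ (proj₂ (ext b)))
    where
    sides : ∀ b → Orientable (Side.sub b)
    sides true  = o
    sides false = o'
    ext = λ b → Side.extend-colouring b (sides b)

theorem1 : (G : RibbonGraph) → WF G → Connected G →
    (A : EdgeSet (m G)) → (∀ e → T (A e) → T (E G e)) →
    (Biseparation G A ⇔ (γ (G ^ A) ≡ γ (G ∣ A) +ℤ γ (G ⊖ A)))
    × (Biseparation G A → (Orientable (G ^ A) ⇔ (Orientable (G ∣ A) × Orientable (G ⊖ A))))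
theorem1 G wf conn A A⊆E =
  mk⇔ (Equivalence.from genus⇔balanced ∘ biseparation⇒balanced) (balanced⇒biseparation ∘ Equivalence.to genus⇔balanced) ,
  λ bisep → mk⇔
    (λ o → let o' = Equivalence.to dual-orientable o in On.sub-orientable o' , Off.sub-orientable o')
    (λ (o , o') → Equivalence.from dual-orientable (orientable-glued bisep o o'))
  where
  open Balance G wf conn A A⊆E
  open Dual G wf A
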